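{- Let $d\ge 1$ be a fixed integer and $q$ a fixed prime power. For $n\ge 1$, choose $a_0(x),\ldots,a_{n-1}(x)\in\mathbb{F}_q[x]$ independently and uniformly at random from the set of polynomials of degree at most $d$, and let $$f(x,y)=y^n+a_{n-1}(x)y^{n-1}+\cdots+a_1(x)y+a_0(x)\in\mathbb{F}_q[x][y].$$ Then $$\lim_{n\to\infty}\mathbb{P}(f\text{ is irreducible})=1-\frac{1}{q^d}.$$
   Context: Irreducibility of $f$ is as a polynomial in $y$ over $\mathbb{F}_q(x)$ (equivalently, since $f$ is monic in $y$, in $\mathbb{F}_q[x,y]$). -}

module Defs where

open import Level using (Level; _⊔_)
open import Algebra.Bundles using (CommutativeRing)
open import Algebra.Bundles.Raw using (RawRing)
open import Data.Nat using (ℕ; zero; suc)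
open import Data.Fin using (Fin)
open import Data.Bool using (Bool; true; false; if_then_else_)
open import Data.List using (List; []; _∷_; map; length; filter; allFin; concatMap; [_])
open import Data.Vec using (Vec; []; _∷_; toList)
open import Data.Product using (Σ; ∃; _×_; _,_)
open import Data.Sum using (_⊎_)
open import Data.Integer using (+_)
open import Data.Rational using (ℚ; 0ℚ; _/_)
open import Relation.Nullary using (¬_)
open import Relation.Binary.PropositionalEquality using (_≡_)

record IsField {c ℓ : Level} (R : CommutativeRing c ℓ) : Set (c ⊔ ℓ) where
  open CommutativeRing R
  field
    1≉0     : ¬ (1# ≈ 0#)
    inverse : ∀ x → ¬ (x ≈ 0#) → ∃ λ y → x * y ≈ 1#

record HasCard {c ℓ : Level} (R : CommutativeRing c ℓ) (q : ℕ) : Set (c ⊔ ℓ) where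
  open CommutativeRing R
  field
    enum      : Fin q → Carrier
    enum-inj  : ∀ i j → enum i ≈ enum j → i ≡ j
    enum-surj : ∀ x → ∃ λ i → enum i ≈ x

-- Univariate polynomials over a raw ring, as coefficient lists
-- (constant coefficient first), with equality up to trailing zeros.

module PolyOps {c ℓ : Level} (R : RawRing c ℓ) where
  open RawRing R

  Poly : Set c
  Poly = List Carrier

  infix 4 _≈P_
  data _≈P_ : Poly → Poly → Set (c ⊔ ℓ) where
    nil≈nil  : [] ≈P []
    nil≈cons : ∀ {b q} → b ≈ 0# → [] ≈P q → [] ≈P (b ∷ q)
    cons≈nil : ∀ {a p} → a ≈ 0# → p ≈P [] → (a ∷ p) ≈P []
    cons≈cons : ∀ {a b p q} → a ≈ b → p ≈P q → (a ∷ p) ≈P (b ∷ q)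

  _+P_ : Poly → Poly → Poly
  [] +P q = q
  (a ∷ p) +P [] = a ∷ p
  (a ∷ p) +P (b ∷ q) = (a + b) ∷ (p +P q)

  _*P_ : Poly → Poly → Poly
  [] *P q = []
  (a ∷ p) *P q = map (a *_) q +P (0# ∷ (p *P q))

  -P_ : Poly → Poly
  -P p = map -_ p

PolyRing : {c ℓ : Level} → RawRing c ℓ → RawRing c (c ⊔ ℓ)
PolyRing R = record
  { Carrier = Poly
  ; _≈_ = _≈P_
  ; _+_ = _+P_
  ; _*_ = _*P_
  ; -_ = -P_
  ; 0# = []
  ; 1# = 1# ∷ []
  }
  where
  open RawRing R
  open PolyOps R

module _ {c ℓ : Level} (S : RawRing c ℓ) where
  open RawRing S

  IsUnit : Carrier → Set (c ⊔ ℓ)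
  IsUnit u = ∃ λ v → u * v ≈ 1#

  Irreducible : Carrier → Set (c ⊔ ℓ)
  Irreducible p = (¬ IsUnit p) × (∀ g h → p ≈ g * h → IsUnit g ⊎ IsUnit h)

-- A sample: n polynomials a_0 .. a_{n-1} of degree ≤ d, each given by
-- its d+1 coefficients (indices into the enumeration Fin q of F_q).
Sample : ℕ → ℕ → ℕ → Set
Sample q d n = Vec (Vec (Fin q) (suc d)) n

allVecs : {A : Set} → (k : ℕ) → List A → List (Vec A k)
allVecs zero xs = [] ∷ []
allVecs (suc k) xs = concatMap (λ x → map (x ∷_) (allVecs k xs)) xs

-- all samples (each listed exactly once; there are q^((d+1) n) of them)
allSamples : (q d n : ℕ) → List (Sample q d n)
allSamples q d n = allVecs n (allVecs (suc d) (allFin q))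

count : (q d n : ℕ) → (Sample q d n → Bool) → ℕ
count q d n χ = length (filter (λ s → χ s Data.Bool.≟ true) (allSamples q d n))

-- the polynomial f(x,y) = y^n + a_{n-1}(x) y^{n-1} + ... + a_0(x)
-- as an element of F[x][y] (coefficient list in y of polys in x)
module _ {c ℓ : Level} (F : CommutativeRing c ℓ) {q : ℕ} (E : HasCard F q) where
  open CommutativeRing F using (rawRing; 1#)
  open HasCard E

  Fx : RawRing c (c ⊔ ℓ)
  Fx = PolyRing rawRing

  Fxy : RawRing c (c ⊔ ℓ)
  Fxy = PolyRing Fx

  coeffPoly : {d : ℕ} → Vec (Fin q) (suc d) → RawRing.Carrier Fx
  coeffPoly v = map enum (toList v)

  fPoly : {d n : ℕ} → Sample q d n → RawRing.Carrier Fxy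
  fPoly {n = n} s = go s
    where
    go : {m : ℕ} → Vec (Vec (Fin q) _) m → RawRing.Carrier Fxy
    go [] = (1# ∷ []) ∷ []
    go (a ∷ as) = coeffPoly a ∷ go as

-- a/b as a rational (b is always nonzero in our use; 0 if b = 0)
ratio : ℕ → ℕ → ℚ
ratio a zero = 0ℚ
ratio a (suc b) = + a / suc b

{-# OPTIONS --safe #-}
module Submission where

-- Write f = Σ f_i(y) x^i with i ≤ d, so that f_0 is monic of degree n and the other f_i have smaller
-- degree, and put Q = q^(d+1).  A factorisation of f either has a factor in F[y], which then divides the
-- content gcd(f_0, …, f_d), or its two monic factors both have x-degree at most d - 1.  There are at
-- most (n+1) q^(dn) products of the latter kind, a proportion (n+1)/q^n of the Q^n samples.  Conversely
-- an irreducible f with nontrivial content lies in F[y], which happens for at most q^n samples.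
-- Finally, exactly q Q^(n-1) samples have nontrivial content: writing the content as a + y g with
-- g monic and f = (a + y g) h, the map f ↦ (a, g h) is a bijection onto F × {samples of length n-1}.

open import Defs
open import Level using (Level; _⊔_)
open import Algebra.Bundles using (CommutativeRing)
open import Algebra.Structures using (IsCommutativeRing)
open import Data.Bool using (Bool; true)
open import Data.Empty using (⊥-elim)
open import Data.Fin using (Fin; zero; suc)
open import Data.Integer as ℤ using (ℤ; +_; -[1+_]; +[1+_]; +<+)
open import Data.List using (List; []; _∷_; map; length; _++_; filter; allFin; concatMap; cartesianProductWith; upTo)
open import Data.List.Membership.Propositional using (_∈_; _∉_; lose)
open import Data.List.Membership.Propositional.Properties using (∈-∃++; ∈-++⁺ˡ; ∈-++⁺ʳ; ∈-++⁻; ∈-filter⁺; ∈-filter⁻; ∈-cartesianProductWith⁺; ∈-cartesianProductWith⁻; ∈-allFin; ∈-concatMap⁺; ∈-upTo⁺; ∈-upTo⁻; ∈-map⁺)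
open import Data.List.Properties using (length-++; length-map; length-tabulate; length-upTo)
open import Data.List.Relation.Unary.All using ([]; _∷_)
open import Data.List.Relation.Unary.AllPairs using ([]; _∷_)
open import Data.List.Relation.Unary.Any using (here; there)
open import Data.List.Relation.Unary.Unique.Propositional using (Unique)
open import Data.List.Relation.Unary.Unique.Propositional.Properties using (Unique[x∷xs]⇒x∉xs; ++⁺; filter⁺; cartesianProductWith⁺; allFin⁺)
open import Data.Nat as ℕ using (ℕ; zero; suc; _≤_; z≤n; s≤s; _^_)
open import Data.Product using (∃; _×_; _,_; proj₁; proj₂)
open import Data.Rational.Unnormalised as ℚᵘ using (mkℚᵘ; *≡*; _≃_)
open import Data.Sum using (_⊎_; inj₁; inj₂)
open import Data.Vec as Vec using (Vec; []; _∷_)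
open import Data.Vec.Properties using (∷-injective; ≡-dec)
open import Function.Bundles using (_⇔_; Equivalence)
open import Relation.Binary.Definitions using (DecidableEquality; tri<; tri≈; tri>)
open import Relation.Binary.PropositionalEquality as ≡ using (_≡_)
open import Relation.Nullary using (¬_; Dec; yes; no; ¬?)
import Data.Fin.Properties as Finₚ
import Data.Integer.Properties as ℤₚ
import Data.Integer.Tactic.RingSolver as ℤ-Solver
import Data.List.Membership.DecPropositional as DecMembership
import Data.Nat.Properties as ℕₚ
import Data.Nat.Tactic.RingSolver as ℕ-Solver
import Data.Rational.Properties as ℚₚ
import Data.Rational.Unnormalised.Properties as ℚᵘₚ
import Relation.Binary.Reasoning.Setoid as SetoidReasoning

-- The polynomial ring

-- A factor in F[y] leaves its cofactor the full x-degree d, so factorisations of this kind are not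
-- negligible: they yield the main term `q Q^(n-1) / Q^n = 1 / q^d` and must be counted exactly. If
-- both factors have positive x-degree, each gives up at least one coefficient of x in every
-- coefficient of y; a split of the y-degree as m + (n - m) then offers only
-- `q^(dm) q^(d(n-m)) = q^(dn)` pairs, and there are n + 1 splits. The exact count rests on the
-- uniqueness of the content. It is obtained without unique factorisation or Gauss's lemma: the
-- content e of f comes with an F[y]-linear map φ, assembled from Bézout coefficients, such that
-- φ(f) = e. If f = e h, then φ(h) = 1, and applying φ to any other factorisation f = g k with g in
-- F[y] gives e = g φ(k), so g divides e. Euclid's algorithm has a monic polynomial to start from
-- because f_0 is monic.

module Polynomial {c ℓ : Level} (R : CommutativeRing c ℓ) where
  open CommutativeRing R
  open PolyOps rawRing public
  open SetoidReasoning setoid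
  open import Algebra.Properties.Ring ring using (-0#≈0#)

  -- Lists that differ by trailing zeros represent the same polynomial. Through `coeff-cong` and
  -- `coeff-ext`, `_≈P_` becomes pointwise equality of coefficients, and the additive laws reduce to
  -- those of the base ring.
  coeff : Poly → ℕ → Carrier
  coeff []      _       = 0#
  coeff (a ∷ p) zero    = a
  coeff (a ∷ p) (suc i) = coeff p i

  coeff-cong : ∀ {p q} → p ≈P q → ∀ i → coeff p i ≈ coeff q i
  coeff-cong nil≈nil         i       = refl
  coeff-cong (nil≈cons b e)  zero    = sym b
  coeff-cong (nil≈cons b e)  (suc i) = coeff-cong e i
  coeff-cong (cons≈nil a e)  zero    = a
  coeff-cong (cons≈nil a e)  (suc i) = coeff-cong e i
  coeff-cong (cons≈cons a e) zero    = a
  coeff-cong (cons≈cons a e) (suc i) = coeff-cong e i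

  coeff-ext : ∀ {p q} → (∀ i → coeff p i ≈ coeff q i) → p ≈P q
  coeff-ext {[]}    {[]}    h = nil≈nil
  coeff-ext {[]}    {b ∷ q} h = nil≈cons (sym (h 0)) (coeff-ext (λ i → h (suc i)))
  coeff-ext {a ∷ p} {[]}    h = cons≈nil (h 0) (coeff-ext (λ i → h (suc i)))
  coeff-ext {a ∷ p} {b ∷ q} h = cons≈cons (h 0) (coeff-ext (λ i → h (suc i)))

  coeff-+ : ∀ p q i → coeff (p +P q) i ≈ coeff p i + coeff q i
  coeff-+ []      q       i       = sym (+-identityˡ _)
  coeff-+ (a ∷ p) []      i       = sym (+-identityʳ _)
  coeff-+ (a ∷ p) (b ∷ q) zero    = refl
  coeff-+ (a ∷ p) (b ∷ q) (suc i) = coeff-+ p q i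

  coeff-neg : ∀ p i → coeff (-P p) i ≈ - coeff p i
  coeff-neg []      i       = sym -0#≈0#
  coeff-neg (a ∷ p) zero    = refl
  coeff-neg (a ∷ p) (suc i) = coeff-neg p i

  scale : Carrier → Poly → Poly
  scale a = map (a *_)

  coeff-scale : ∀ a p i → coeff (scale a p) i ≈ a * coeff p i
  coeff-scale a []      i       = sym (zeroʳ a)
  coeff-scale a (b ∷ p) zero    = refl
  coeff-scale a (b ∷ p) (suc i) = coeff-scale a p i

  ≈P-refl : ∀ {p} → p ≈P p
  ≈P-refl = coeff-ext λ _ → refl

  ≈P-sym : ∀ {p q} → p ≈P q → q ≈P p
  ≈P-sym e = coeff-ext λ i → sym (coeff-cong e i)

  ≈P-trans : ∀ {p q r} → p ≈P q → q ≈P r → p ≈P r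
  ≈P-trans e f = coeff-ext λ i → trans (coeff-cong e i) (coeff-cong f i)

  +P-cong : ∀ {p p′ q q′} → p ≈P p′ → q ≈P q′ → (p +P q) ≈P (p′ +P q′)
  +P-cong {p} {p′} {q} {q′} e f = coeff-ext λ i →
    trans (coeff-+ p q i) (trans (+-cong (coeff-cong e i) (coeff-cong f i)) (sym (coeff-+ p′ q′ i)))

  -P-cong : ∀ {p q} → p ≈P q → (-P p) ≈P (-P q)
  -P-cong {p} {q} e = coeff-ext λ i →
    trans (coeff-neg p i) (trans (-‿cong (coeff-cong e i)) (sym (coeff-neg q i)))

  scale-cong : ∀ {a b p q} → a ≈ b → p ≈P q → scale a p ≈P scale b q
  scale-cong {a} {b} {p} {q} e f = coeff-ext λ i →
    trans (coeff-scale a p i) (trans (*-cong e (coeff-cong f i)) (sym (coeff-scale b q i)))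

  +P-assoc : ∀ p q r → ((p +P q) +P r) ≈P (p +P (q +P r))
  +P-assoc p q r = coeff-ext λ i → begin
    coeff ((p +P q) +P r) i            ≈⟨ coeff-+ (p +P q) r i ⟩
    coeff (p +P q) i + coeff r i       ≈⟨ +-congʳ (coeff-+ p q i) ⟩
    coeff p i + coeff q i + coeff r i  ≈⟨ +-assoc _ _ _ ⟩
    coeff p i + (coeff q i + coeff r i) ≈⟨ +-congˡ (coeff-+ q r i) ⟨
    coeff p i + coeff (q +P r) i       ≈⟨ coeff-+ p (q +P r) i ⟨
    coeff (p +P (q +P r)) i            ∎

  +P-comm : ∀ p q → (p +P q) ≈P (q +P p)
  +P-comm p q = coeff-ext λ i →
    trans (coeff-+ p q i) (trans (+-comm _ _) (sym (coeff-+ q p i)))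

  +P-identityʳ : ∀ p → (p +P []) ≈P p
  +P-identityʳ []      = ≈P-refl
  +P-identityʳ (a ∷ p) = ≈P-refl

  +P-inverseʳ : ∀ p → (p +P (-P p)) ≈P []
  +P-inverseʳ p = coeff-ext λ i →
    trans (coeff-+ p (-P p) i) (trans (+-congˡ (coeff-neg p i)) (-‿inverseʳ _))

  scale-+P : ∀ a p q → scale a (p +P q) ≈P (scale a p +P scale a q)
  scale-+P a p q = coeff-ext λ i → begin
    coeff (scale a (p +P q)) i            ≈⟨ coeff-scale a (p +P q) i ⟩
    a * coeff (p +P q) i                  ≈⟨ *-congˡ (coeff-+ p q i) ⟩
    a * (coeff p i + coeff q i)           ≈⟨ distribˡ a _ _ ⟩
    a * coeff p i + a * coeff q i         ≈⟨ +-cong (coeff-scale a p i) (coeff-scale a q i) ⟨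
    coeff (scale a p) i + coeff (scale a q) i ≈⟨ coeff-+ (scale a p) (scale a q) i ⟨
    coeff (scale a p +P scale a q) i      ∎

  scale-+ : ∀ a b p → scale (a + b) p ≈P (scale a p +P scale b p)
  scale-+ a b p = coeff-ext λ i → begin
    coeff (scale (a + b) p) i             ≈⟨ coeff-scale (a + b) p i ⟩
    (a + b) * coeff p i                   ≈⟨ distribʳ _ a b ⟩
    a * coeff p i + b * coeff p i         ≈⟨ +-cong (coeff-scale a p i) (coeff-scale b p i) ⟨
    coeff (scale a p) i + coeff (scale b p) i ≈⟨ coeff-+ (scale a p) (scale b p) i ⟨
    coeff (scale a p +P scale b p) i      ∎

  scale-scale : ∀ a b p → scale (a * b) p ≈P scale a (scale b p)
  scale-scale a b p = coeff-ext λ i → begin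
    coeff (scale (a * b) p) i   ≈⟨ coeff-scale (a * b) p i ⟩
    a * b * coeff p i           ≈⟨ *-assoc a b _ ⟩
    a * (b * coeff p i)         ≈⟨ *-congˡ (coeff-scale b p i) ⟨
    a * coeff (scale b p) i     ≈⟨ coeff-scale a (scale b p) i ⟨
    coeff (scale a (scale b p)) i ∎

  scale-0 : ∀ {a} p → a ≈ 0# → scale a p ≈P []
  scale-0 {a} p e = coeff-ext λ i → trans (coeff-scale a p i) (trans (*-congʳ e) (zeroˡ _))

  shift-0 : ∀ {p} → p ≈P [] → (0# ∷ p) ≈P []
  shift-0 e = cons≈nil refl e

  shift-+P : ∀ p q → (0# ∷ (p +P q)) ≈P ((0# ∷ p) +P (0# ∷ q))
  shift-+P p q = cons≈cons (sym (+-identityʳ 0#)) ≈P-refl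

  interchange : ∀ p q r s → ((p +P q) +P (r +P s)) ≈P ((p +P r) +P (q +P s))
  interchange p q r s =
    ≈P-trans (+P-assoc p q (r +P s))
   (≈P-trans (+P-cong (≈P-refl {p})
      (≈P-trans (≈P-sym (+P-assoc q r s))
      (≈P-trans (+P-cong (+P-comm q r) ≈P-refl) (+P-assoc r q s))))
    (≈P-sym (+P-assoc p r (q +P s))))

  *P-zeroˡ : ∀ {p} q → p ≈P [] → (p *P q) ≈P []
  *P-zeroˡ         q nil≈nil        = ≈P-refl
  *P-zeroˡ {a ∷ p} q (cons≈nil z e) = +P-cong (scale-0 q z) (shift-0 (*P-zeroˡ q e))

  *P-congʳ : ∀ {p p′} q → p ≈P p′ → (p *P q) ≈P (p′ *P q)
  *P-congʳ q nil≈nil         = ≈P-refl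
  *P-congʳ q e@(nil≈cons _ _) = ≈P-sym (*P-zeroˡ q (≈P-sym e))
  *P-congʳ q e@(cons≈nil _ _) = *P-zeroˡ q e
  *P-congʳ q (cons≈cons a e) =
    +P-cong (scale-cong a ≈P-refl) (cons≈cons refl (*P-congʳ q e))

  *P-zeroʳ : ∀ p → (p *P []) ≈P []
  *P-zeroʳ []      = ≈P-refl
  *P-zeroʳ (a ∷ p) = shift-0 (*P-zeroʳ p)

  -- Mirrors the defining recursion of `_*P_` in the right factor, which is what the induction for
  -- commutativity consumes.
  *P-∷ʳ : ∀ p b q → (p *P (b ∷ q)) ≈P (scale b p +P (0# ∷ (p *P q)))
  *P-∷ʳ []      b q = ≈P-sym (shift-0 ≈P-refl)
  *P-∷ʳ (a ∷ p) b q = cons≈cons (+-congʳ (*-comm a b))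
    (≈P-trans (+P-cong ≈P-refl (*P-∷ʳ p b q))
    (≈P-trans (≈P-sym (+P-assoc (scale a q) (scale b p) _))
    (≈P-trans (+P-cong (+P-comm (scale a q) (scale b p)) ≈P-refl)
              (+P-assoc (scale b p) (scale a q) _))))

  *P-comm : ∀ p q → (p *P q) ≈P (q *P p)
  *P-comm []      q = ≈P-sym (*P-zeroʳ q)
  *P-comm (a ∷ p) q =
    ≈P-trans (+P-cong ≈P-refl (cons≈cons refl (*P-comm p q))) (≈P-sym (*P-∷ʳ q a p))

  *P-cong : ∀ {p p′ q q′} → p ≈P p′ → q ≈P q′ → (p *P q) ≈P (p′ *P q′)
  *P-cong {p} {p′} {q} {q′} e f =
    ≈P-trans (*P-congʳ q e) (≈P-trans (*P-comm p′ q) (≈P-trans (*P-congʳ p′ f) (*P-comm q′ p′)))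

  *P-distribʳ : ∀ r p q → ((p +P q) *P r) ≈P ((p *P r) +P (q *P r))
  *P-distribʳ r []      q       = ≈P-refl
  *P-distribʳ r (a ∷ p) []      = ≈P-sym (+P-identityʳ _)
  *P-distribʳ r (a ∷ p) (b ∷ q) =
    ≈P-trans (+P-cong (scale-+ a b r)
                      (≈P-trans (cons≈cons refl (*P-distribʳ r p q)) (shift-+P (p *P r) (q *P r))))
             (interchange (scale a r) (scale b r) _ _)

  *P-distribˡ : ∀ r p q → (r *P (p +P q)) ≈P ((r *P p) +P (r *P q))
  *P-distribˡ r p q = ≈P-trans (*P-comm r (p +P q))
    (≈P-trans (*P-distribʳ r p q) (+P-cong (*P-comm p r) (*P-comm q r)))

  shift-*P : ∀ p q → ((0# ∷ p) *P q) ≈P (0# ∷ (p *P q))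
  shift-*P p q = +P-cong (scale-0 q refl) ≈P-refl

  scale-*P : ∀ a p q → (scale a p *P q) ≈P scale a (p *P q)
  scale-*P a []      q = ≈P-refl
  scale-*P a (b ∷ p) q =
    ≈P-trans (+P-cong (scale-scale a b q) (cons≈cons (sym (zeroʳ a)) (scale-*P a p q)))
             (≈P-sym (scale-+P a (scale b q) (0# ∷ (p *P q))))

  *P-assoc : ∀ p q r → ((p *P q) *P r) ≈P (p *P (q *P r))
  *P-assoc []      q r = ≈P-refl
  *P-assoc (a ∷ p) q r =
    ≈P-trans (*P-distribʳ r (scale a q) (0# ∷ (p *P q)))
             (+P-cong (scale-*P a q r)
                      (≈P-trans (shift-*P (p *P q) r) (cons≈cons refl (*P-assoc p q r))))

  constant-*P : ∀ a p → ((a ∷ []) *P p) ≈P scale a p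
  constant-*P a p = ≈P-trans (+P-cong ≈P-refl (shift-0 ≈P-refl)) (+P-identityʳ _)

  *P-identityˡ : ∀ p → ((1# ∷ []) *P p) ≈P p
  *P-identityˡ p = ≈P-trans (constant-*P 1# p)
    (coeff-ext λ i → trans (coeff-scale 1# p i) (*-identityˡ _))

  polyRing-isCommutativeRing : IsCommutativeRing _≈P_ _+P_ _*P_ -P_ [] (1# ∷ [])
  polyRing-isCommutativeRing = record
    { isRing = record
      { +-isAbelianGroup = record
        { isGroup = record
          { isMonoid = record
            { isSemigroup = record
              { isMagma = record
                { isEquivalence = record { refl = ≈P-refl ; sym = ≈P-sym ; trans = ≈P-trans }
                ; ∙-cong = +P-cong
                }
              ; assoc = +P-assoc
              }
            ; identity = (λ _ → ≈P-refl) , +P-identityʳ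
            }
          ; inverse = (λ p → ≈P-trans (+P-comm (-P p) p) (+P-inverseʳ p)) , +P-inverseʳ
          ; ⁻¹-cong = -P-cong
          }
        ; comm = +P-comm
        }
      ; *-cong = *P-cong
      ; *-assoc = *P-assoc
      ; *-identity = *P-identityˡ , λ p → ≈P-trans (*P-comm p _) (*P-identityˡ p)
      ; distrib = *P-distribˡ , *P-distribʳ
      }
    ; *-comm = *P-comm
    }

  polyRing : CommutativeRing c (c ⊔ ℓ)
  polyRing = record { isCommutativeRing = polyRing-isCommutativeRing }

-- Degrees and monic polynomials

module Degree {c ℓ : Level} (R : CommutativeRing c ℓ) where
  open CommutativeRing R
  open Polynomial R
  open SetoidReasoning setoid

  -- Records rather than functions, so that the polynomial can be inferred.
  record Below (k : ℕ) (p : Poly) : Set ℓ where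
    constructor below
    field vanish : ∀ i → k ≤ i → coeff p i ≈ 0#
  open Below public

  record Monic (m : ℕ) (p : Poly) : Set ℓ where
    constructor monic
    field
      top≈1 : coeff p m ≈ 1#
      bound : Below (suc m) p

  record Lead (m : ℕ) (p : Poly) : Set ℓ where
    constructor leading
    field
      top≉0 : ¬ (coeff p m ≈ 0#)
      bound : Below (suc m) p

  Below-cong : ∀ {k p q} → p ≈P q → Below k p → Below k q
  Below-cong e b = below λ i k≤i → trans (sym (coeff-cong e i)) (vanish b i k≤i)

  Monic-cong : ∀ {m p q} → p ≈P q → Monic m p → Monic m q
  Monic-cong e (monic t b) = monic (trans (sym (coeff-cong e _)) t) (Below-cong e b)

  Below-0 : ∀ {p} → Below 0 p → p ≈P []
  Below-0 b = coeff-ext λ i → vanish b i z≤n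

  Below-[] : ∀ {k p} → p ≈P [] → Below k p
  Below-[] e = below λ i _ → coeff-cong e i

  Below-tail : ∀ {k a p} → Below (suc k) (a ∷ p) → Below k p
  Below-tail b = below λ i k≤i → vanish b (suc i) (s≤s k≤i)

  Below-∷ : ∀ {k p} a → Below k p → Below (suc k) (a ∷ p)
  Below-∷ a b = below λ { (suc i) (s≤s k≤i) → vanish b i k≤i }

  ∷-*P-constant : ∀ c p q → p ≈P [] → ((c ∷ p) *P q) ≈P scale c q
  ∷-*P-constant c p q e =
    ≈P-trans (*P-congʳ {c ∷ p} {c ∷ []} q (cons≈cons refl e)) (constant-*P c q)

  Below-scale : ∀ {k} c p → Below k p → Below k (scale c p)
  Below-scale c p b = below λ i k≤i →
    trans (coeff-scale c p i) (trans (*-congˡ (vanish b i k≤i)) (zeroʳ c))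

  -- The induction follows the list, but the degree bound may run out first. The rest of the list
  -- then consists of zeros and the left factor acts as the scalar `c`.
  Below-*P : ∀ p {q a b} → Below (suc a) p → Below (suc b) q → Below (suc (a ℕ.+ b)) (p *P q)
  Below-*P [] _ _ = below λ _ _ → refl
  Below-*P (c ∷ p) {q} {zero} bp bq =
    Below-cong (≈P-sym (∷-*P-constant c p q (Below-0 (Below-tail bp)))) (Below-scale c q bq)
  Below-*P (c ∷ p) {q} {suc a} {b} bp bq = below λ i a+b<i → begin
    coeff (scale c q +P (0# ∷ (p *P q))) i         ≈⟨ coeff-+ (scale c q) _ i ⟩
    coeff (scale c q) i + coeff (0# ∷ (p *P q)) i  ≈⟨ +-cong (coeff-scale c q i) (vanish (Below-∷ 0# (Below-*P p (Below-tail bp) bq)) i a+b<i) ⟩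
    c * coeff q i + 0#                             ≈⟨ +-identityʳ _ ⟩
    c * coeff q i                                  ≈⟨ *-congˡ (vanish bq i (ℕₚ.≤-trans (s≤s (ℕₚ.m≤n+m b (suc a))) a+b<i)) ⟩
    c * 0#                                         ≈⟨ zeroʳ c ⟩
    0#                                             ∎

  coeff-*P-top : ∀ p q a b → Below (suc a) p → Below (suc b) q →
                 coeff (p *P q) (a ℕ.+ b) ≈ coeff p a * coeff q b
  coeff-*P-top [] q a b _ _ = sym (zeroˡ _)
  coeff-*P-top (c ∷ p) q zero b bp bq = trans
    (coeff-cong (∷-*P-constant c p q (Below-0 (Below-tail bp))) b) (coeff-scale c q b)
  coeff-*P-top (c ∷ p) q (suc a) b bp bq = begin
    coeff (scale c q +P (0# ∷ (p *P q))) (suc (a ℕ.+ b))      ≈⟨ coeff-+ (scale c q) _ (suc (a ℕ.+ b)) ⟩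
    coeff (scale c q) (suc (a ℕ.+ b)) + coeff (p *P q) (a ℕ.+ b)  ≈⟨ +-cong (coeff-scale c q (suc (a ℕ.+ b))) (coeff-*P-top p q a b (Below-tail bp) bq) ⟩
    c * coeff q (suc (a ℕ.+ b)) + coeff p a * coeff q b       ≈⟨ +-congʳ (*-congˡ (vanish bq _ (s≤s (ℕₚ.m≤n+m b a)))) ⟩
    c * 0# + coeff p a * coeff q b                            ≈⟨ +-congʳ (zeroʳ c) ⟩
    0# + coeff p a * coeff q b                                ≈⟨ +-identityˡ _ ⟩
    coeff p a * coeff q b                                     ∎

  Monic-*P : ∀ {a b p q} → Monic a p → Monic b q → Monic (a ℕ.+ b) (p *P q)
  Monic-*P {a} {b} {p} {q} (monic tp bp) (monic tq bq) = monic
    (trans (coeff-*P-top p q a b bp bq) (trans (*-cong tp tq) (*-identityˡ 1#))) (Below-*P p bp bq)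

  Monic-∷ : ∀ {m p} a → Monic m p → Monic (suc m) (a ∷ p)
  Monic-∷ a (monic t b) = monic t (Below-∷ a b)

  Monic-tail : ∀ {m a p} → Monic (suc m) (a ∷ p) → Monic m p
  Monic-tail (monic t b) = monic t (Below-tail b)

  Monic-0 : ∀ {p} → Monic 0 p → p ≈P (1# ∷ [])
  Monic-0 (monic t b) = coeff-ext λ { zero → t ; (suc i) → vanish b (suc i) (s≤s z≤n) }

  Monic-normalise : ∀ {w k p} → w * coeff p k ≈ 1# → Below (suc k) p → Monic k ((w ∷ []) *P p)
  Monic-normalise {w} {k} {p} e b = Monic-cong (≈P-sym (constant-*P w p))
    (monic (trans (coeff-scale w p k) e) (Below-scale w p b))

  Lead-unique : ∀ {j k p} → Lead j p → Lead k p → j ≡ k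
  Lead-unique {j} {k} (leading tj bj) (leading tk bk) with ℕₚ.<-cmp j k
  ... | tri< j<k _ _ = ⊥-elim (tk (vanish bj k j<k))
  ... | tri≈ _ j≡k _ = j≡k
  ... | tri> _ _ k<j = ⊥-elim (tj (vanish bk j k<j))

  -- Horner's scheme: from `f = p q + r` one gets `c + y f = p (y q) + (c + y r)`, and subtracting
  -- `u p` removes the coefficient `u` of degree `m`. No inverse is taken, so this applies over F in
  -- Euclid's algorithm and also over F[x], where contents are divided out.
  divMod : ∀ {m p} → Monic m p → ∀ f → ∃ λ q → ∃ λ r → (f ≈P ((p *P q) +P r)) × Below m r
  divMod {p = p} _ [] = [] , [] , ≈P-sym (≈P-trans (+P-identityʳ (p *P [])) (*P-zeroʳ p)) , below λ _ _ → refl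
  divMod {m} {p} mp@(monic t b) (c ∷ f) with divMod mp f
  ... | q , r , e , br = u ∷ q , r′ , eq , below br′
    where
    u = coeff (c ∷ r) m
    r′ = (c ∷ r) +P (-P scale u p)

    coeff-r′ : ∀ i → coeff r′ i ≈ coeff (c ∷ r) i - u * coeff p i
    coeff-r′ i = trans (coeff-+ (c ∷ r) (-P scale u p) i)
      (+-congˡ (trans (coeff-neg (scale u p) i) (-‿cong (coeff-scale u p i))))

    rearrange : ∀ s x y → y + x ≈ (s + y) + (x - s)
    rearrange s x y = sym (begin
      (s + y) + (x - s) ≈⟨ +-cong (+-comm s y) (+-comm x (- s)) ⟩
      (y + s) + (- s + x) ≈⟨ +-assoc y s _ ⟩
      y + (s + (- s + x)) ≈⟨ +-congˡ (+-assoc s (- s) x) ⟨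
      y + ((s - s) + x)   ≈⟨ +-congˡ (+-congʳ (-‿inverseʳ s)) ⟩
      y + (0# + x)        ≈⟨ +-congˡ (+-identityˡ x) ⟩
      y + x               ∎)

    eq : (c ∷ f) ≈P ((p *P (u ∷ q)) +P r′)
    eq = coeff-ext λ i → begin
      coeff (c ∷ f) i
        ≈⟨ coeff-cong (cons≈cons (sym (+-identityˡ c)) e) i ⟩
      coeff ((0# ∷ (p *P q)) +P (c ∷ r)) i
        ≈⟨ coeff-+ (0# ∷ (p *P q)) (c ∷ r) i ⟩
      coeff (0# ∷ (p *P q)) i + coeff (c ∷ r) i
        ≈⟨ rearrange (u * coeff p i) _ _ ⟩
      (u * coeff p i + coeff (0# ∷ (p *P q)) i) + (coeff (c ∷ r) i - u * coeff p i)
        ≈⟨ +-cong (+-congʳ (coeff-scale u p i)) (coeff-r′ i) ⟨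
      (coeff (scale u p) i + coeff (0# ∷ (p *P q)) i) + coeff r′ i
        ≈⟨ +-congʳ (trans (coeff-cong (*P-∷ʳ p u q) i) (coeff-+ (scale u p) _ i)) ⟨
      coeff (p *P (u ∷ q)) i + coeff r′ i
        ≈⟨ coeff-+ (p *P (u ∷ q)) r′ i ⟨
      coeff ((p *P (u ∷ q)) +P r′) i ∎

    br′ : ∀ i → m ≤ i → coeff r′ i ≈ 0#
    br′ i m≤i with ℕₚ.m≤n⇒m<n∨m≡n m≤i
    ... | inj₂ ≡.refl = trans (coeff-r′ m) (trans (+-congˡ (-‿cong (trans (*-congˡ t) (*-identityʳ u)))) (-‿inverseʳ u))
    br′ (suc i) _ | inj₁ m<i@(s≤s m≤i) = trans (coeff-r′ (suc i))
      (trans (+-cong (vanish br i m≤i) (-‿cong (trans (*-congˡ (vanish b (suc i) m<i)) (zeroʳ u)))) (-‿inverseʳ 0#))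

-- Weaker than a field on purpose: the degree theory is instantiated both at F and, through
-- `polyDomain`, at F[x]. The zero test is what locates leading coefficients in lists with trailing
-- zeros.
record IsDecidableDomain {c ℓ : Level} (R : CommutativeRing c ℓ) : Set (c ⊔ ℓ) where
  open CommutativeRing R
  field
    zero?  : ∀ x → Dec (x ≈ 0#)
    1≉0    : ¬ (1# ≈ 0#)
    *-≉0   : ∀ {x y} → ¬ (x ≈ 0#) → ¬ (y ≈ 0#) → ¬ (x * y ≈ 0#)

module DomainDegree {c ℓ : Level} {R : CommutativeRing c ℓ} (D : IsDecidableDomain R) where
  open CommutativeRing R
  open IsDecidableDomain D
  open Polynomial R
  open Degree R
  private
    module P = CommutativeRing polyRing
  open import Algebra.Properties.Ring P.ring using (-‿distribʳ-*; x∙y⁻¹≈ε⇒x≈y)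

  lead : ∀ p → (p ≈P []) ⊎ ∃ λ k → Lead k p
  lead []      = inj₁ P.refl
  lead (a ∷ p) with lead p
  ... | inj₂ (k , leading t b) = inj₂ (suc k , leading t (Below-∷ a b))
  ... | inj₁ e with zero? a
  ...   | yes z = inj₁ (cons≈nil z e)
  ...   | no z  = inj₂ (0 , leading z (Below-∷ a (Below-[] e)))

  Lead-≉0 : ∀ {k p} → Lead k p → ¬ (p ≈P [])
  Lead-≉0 (leading t _) e = t (coeff-cong e _)

  Monic⇒Lead : ∀ {k p} → Monic k p → Lead k p
  Monic⇒Lead (monic t b) = leading (λ z → 1≉0 (trans (sym t) z)) b

  Lead-*P : ∀ {j k p q} → Lead j p → Lead k q → Lead (j ℕ.+ k) (p *P q)
  Lead-*P {j} {k} {p} {q} (leading tp bp) (leading tq bq) =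
    leading (λ z → *-≉0 tp tq (trans (sym (coeff-*P-top p q j k bp bq)) z)) (Below-*P p bp bq)

  polyDomain : IsDecidableDomain polyRing
  polyDomain = record
    { zero? = zero?P
    ; 1≉0   = λ e → 1≉0 (coeff-cong e 0)
    ; *-≉0  = λ {p} {q} → *P-≉0 p q
    }
    where
    zero?P : ∀ p → Dec (p ≈P [])
    zero?P p with lead p
    ... | inj₁ e       = yes e
    ... | inj₂ (k , l) = no (Lead-≉0 l)

    *P-≉0 : ∀ p q → ¬ (p ≈P []) → ¬ (q ≈P []) → ¬ ((p *P q) ≈P [])
    *P-≉0 p q np nq with lead p | lead q
    ... | inj₁ e       | _            = ⊥-elim (np e)
    ... | inj₂ _       | inj₁ e       = ⊥-elim (nq e)
    ... | inj₂ (_ , l) | inj₂ (_ , k) = Lead-≉0 (Lead-*P l k)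

  -- In a domain degrees add, so a nonzero multiple of a monic polynomial is at least as long.
  -- Cancellation, `XBelow-cofactor` and the vanishing of the remainder in `decompose` all rest on
  -- this.
  Below-multiple : ∀ {m p} k → Monic m p → Below m (p *P k) → k ≈P []
  Below-multiple {m} k mp b with lead k
  ... | inj₁ e       = e
  ... | inj₂ (j , l) = ⊥-elim (Lead.top≉0 (Lead-*P (Monic⇒Lead mp) l) (vanish b (m ℕ.+ j) (ℕₚ.m≤m+n m j)))

  Monic-cancelˡ : ∀ {m p} h k → Monic m p → (p *P h) ≈P (p *P k) → h ≈P k
  Monic-cancelˡ {p = p} h k mp e = x∙y⁻¹≈ε⇒x≈y h k (Below-multiple (h +P (-P k)) mp (Below-[]
    (P.trans (P.distribˡ p h (-P k))
    (P.trans (P.+-cong {p *P h} e (P.sym (-‿distribʳ-* p k))) (P.-‿inverseʳ (p *P k))))))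

  Monic-quotient : ∀ {m n p} k → Monic m p → Monic n (p *P k) → ∃ λ j → (m ℕ.+ j ≡ n) × Monic j k
  Monic-quotient {m} {n} {p} k mp mpk with lead k
  ... | inj₁ e = ⊥-elim (Lead-≉0 (Monic⇒Lead mpk) (P.trans (P.*-congˡ {p} e) (P.zeroʳ p)))
  ... | inj₂ (j , l@(leading t b)) with Lead-unique (Lead-*P (Monic⇒Lead mp) l) (Monic⇒Lead mpk)
  ...   | ≡.refl = j , ≡.refl , monic
    (trans (sym (trans (coeff-*P-top p k m j (Monic.bound mp) b)
                       (trans (*-congʳ (Monic.top≈1 mp)) (*-identityˡ _)))) (Monic.top≈1 mpk)) b

  Monic-divides-≤ : ∀ {m n p q} k → Monic m p → Monic n q → q ≈P (p *P k) → m ≤ n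
  Monic-divides-≤ {m} k mp mq e with Monic-quotient k mp (Monic-cong e mq)
  ... | j , ≡.refl , _ = ℕₚ.m≤m+n m j

  Monic-antisym : ∀ {m n p q} k l → Monic m p → Monic n q → q ≈P (p *P k) → p ≈P (q *P l) → q ≈P p
  Monic-antisym {m} {n} {p} k l mp mq e f with Monic-quotient k mp (Monic-cong e mq)
  ... | zero , _ , mk = P.trans e (P.trans (P.*-congˡ {p} (Monic-0 mk)) (P.*-identityʳ p))
  ... | suc j , ≡.refl , _ = ⊥-elim (ℕₚ.m+1+n≰m m (Monic-divides-≤ l mq mp f))

  -- The leading coefficients of `g` and `h` multiply to 1, so each is the inverse of the other, and
  -- exchanging them makes both factors monic while preserving the product.
  Monic-factors : ∀ {n} g h → Monic n (g *P h) → ∃ λ u → ∃ λ v → ∃ λ a → ∃ λ b →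
    (u * v ≈ 1#) × (a ℕ.+ b ≡ n) × Monic a ((v ∷ []) *P g) × Monic b ((u ∷ []) *P h)
  Monic-factors {n} g h m with lead g | lead h
  ... | inj₁ e | _      = ⊥-elim (Lead-≉0 (Monic⇒Lead m) (P.trans (*P-congʳ {g} h e) (P.zeroˡ h)))
  ... | inj₂ _ | inj₁ e = ⊥-elim (Lead-≉0 (Monic⇒Lead m) (P.trans (P.*-congˡ {g} e) (P.zeroʳ g)))
  ... | inj₂ (a , lg) | inj₂ (b , lh) with Lead-unique (Lead-*P lg lh) (Monic⇒Lead m)
  ...   | ≡.refl = coeff g a , coeff h b , a , b , uv , ≡.refl ,
          Monic-normalise (trans (*-comm _ _) uv) (Lead.bound lg) , Monic-normalise uv (Lead.bound lh)
    where
    uv : coeff g a * coeff h b ≈ 1#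
    uv = trans (sym (coeff-*P-top g h a b (Lead.bound lg) (Lead.bound lh))) (Monic.top≈1 m)

-- Bézout's identity and the content in F[y] of a bivariate polynomial

module EuclideanStep {c ℓ : Level} (R : CommutativeRing c ℓ) where
  open CommutativeRing R
  open SetoidReasoning setoid
  open import Algebra.Properties.Ring ring using (-‿distribʳ-*)

  -- `C` is the leading coefficient of the remainder and `W` its inverse. Euclid's algorithm
  -- continues with `W * r` in place of `r`, so that the divisor stays monic; `C` undoes this
  -- normalisation.
  step-divides : ∀ {f g q r e x y} C W → f ≈ g * q + r → C * W ≈ 1# → W * r ≈ e * x → g ≈ e * y →
                 f ≈ e * (y * q + C * x)
  step-divides {f} {g} {q} {r} {e} {x} {y} C W eq CW eqr eqg = begin
    f                        ≈⟨ eq ⟩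
    g * q + r                ≈⟨ +-cong (*-congʳ eqg) (sym (*-identityˡ r)) ⟩
    e * y * q + 1# * r       ≈⟨ +-cong (*-assoc e y q) (*-congʳ (sym CW)) ⟩
    e * (y * q) + C * W * r  ≈⟨ +-congˡ (trans (*-assoc C W r) (*-congˡ eqr)) ⟩
    e * (y * q) + C * (e * x) ≈⟨ +-congˡ (trans (sym (*-assoc C e x)) (trans (*-congʳ (*-comm C e)) (*-assoc e C x))) ⟩
    e * (y * q) + e * (C * x) ≈⟨ distribˡ e _ _ ⟨
    e * (y * q + C * x)      ∎

  -- Substitution of `r = f - g * q` into the combination found for `W * r` and `g`.
  step-combination : ∀ {f g q r e u v} W → f ≈ g * q + r → e ≈ W * r * u + g * v →
                     e ≈ g * (v - q * (W * u)) + f * (W * u)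
  step-combination {f} {g} {q} {r} {e} {u} {v} W eq eqe = sym (begin
    g * (v - q * (W * u)) + f * (W * u)
      ≈⟨ +-cong (distribˡ g v _) (trans (*-congʳ eq) (distribʳ (W * u) (g * q) r)) ⟩
    (g * v + g * - (q * (W * u))) + (g * q * (W * u) + r * (W * u))
      ≈⟨ +-cong (+-congˡ (sym (-‿distribʳ-* g _))) (+-cong (*-assoc g q _) (trans (sym (*-assoc r W u)) (*-congʳ (*-comm r W)))) ⟩
    (g * v - g * (q * (W * u))) + (g * (q * (W * u)) + W * r * u)
      ≈⟨ +-assoc _ _ _ ⟩
    g * v + (- (g * (q * (W * u))) + (g * (q * (W * u)) + W * r * u))
      ≈⟨ +-congˡ (trans (sym (+-assoc _ _ _)) (trans (+-congʳ (-‿inverseˡ _)) (+-identityˡ _))) ⟩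
    g * v + W * r * u
      ≈⟨ +-comm _ _ ⟩
    W * r * u + g * v
      ≈⟨ eqe ⟨
    e ∎)

module Bezout {c ℓ : Level} {F : CommutativeRing c ℓ} (isField : IsField F) (D : IsDecidableDomain F) where
  open CommutativeRing F
  open IsField isField using (inverse)
  open Polynomial F
  open Degree F
  open DomainDegree D
  private
    module P = CommutativeRing polyRing
  open EuclideanStep polyRing

  record CommonDivisor (g f : Poly) : Set (c ⊔ ℓ) where
    field
      degree        : ℕ
      divisor       : Poly
      divisor-monic : Monic degree divisor
      cofactorˡ cofactorʳ : Poly
      dividesˡ      : g ≈P (divisor *P cofactorˡ)
      dividesʳ      : f ≈P (divisor *P cofactorʳ)
      u v           : Poly
      combination   : divisor ≈P ((g *P u) +P (f *P v))

  -- The first argument bounds the degree of g and is the recursion measure of Euclid's algorithm.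
  bezout : ∀ N {m g} → m ℕ.< N → Monic m g → ∀ f → CommonDivisor g f
  bezout (suc N) {m} {g} (s≤s m≤N) mg f with divMod mg f
  ... | q , r , f≈ , br with lead r
  ...   | inj₁ r≈0 = record
    { degree = m ; divisor = g ; divisor-monic = mg
    ; cofactorˡ = P.1# ; cofactorʳ = q
    ; dividesˡ = P.sym (P.*-identityʳ g)
    ; dividesʳ = P.trans f≈ (P.trans (P.+-congˡ {g *P q} r≈0) (P.+-identityʳ (g *P q)))
    ; u = P.1# ; v = P.0#
    ; combination = P.sym (P.trans (P.+-cong {g *P P.1#} (P.*-identityʳ g) (P.zeroʳ f)) (P.+-identityʳ g))
    }
  ...   | inj₂ (k , leading t b) with inverse (coeff r k) t
  ...     | w , cw = record
    { degree = degree ; divisor = divisor ; divisor-monic = divisor-monic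
    ; cofactorˡ = cofactorʳ
    ; cofactorʳ = (cofactorʳ *P q) +P (C *P cofactorˡ)
    ; dividesˡ = dividesʳ
    ; dividesʳ = step-divides {f} {g} {q} {r} {divisor} C W f≈ CW dividesˡ dividesʳ
    ; u = v +P (-P (q *P (W *P u))) ; v = W *P u
    ; combination = step-combination {f} {g} {q} {r} {divisor} W f≈ combination
    }
    where
    C W : Poly
    C = coeff r k ∷ []
    W = w ∷ []

    CW : (C *P W) ≈P P.1#
    CW = cons≈cons (trans (+-identityʳ _) cw) P.refl

    k<m : k ℕ.< m
    k<m with m ℕ.≤? k
    ... | yes m≤k = ⊥-elim (t (vanish br k m≤k))
    ... | no m≰k  = ℕₚ.≰⇒> m≰k

    -- The new pair is (`W r`, `g`), with the monic remainder first; the cofactors therefore change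
    -- sides in the record above.
    open CommonDivisor (bezout N (ℕₚ.≤-trans k<m m≤N) (Monic-normalise (trans (*-comm w _) cw) b) g)

-- Coefficients in x, x-degree and content

module Bivariate {c ℓ : Level} {F : CommutativeRing c ℓ} (isField : IsField F) (D : IsDecidableDomain F) where
  private
    module F = CommutativeRing F
    module X = Polynomial F
    module Y = Polynomial X.polyRing
    module A = CommutativeRing X.polyRing
    module B = CommutativeRing Y.polyRing
    module DX where
      open Degree F public
      open DomainDegree D public
    module DY where
      open Degree X.polyRing public
      open DomainDegree DX.polyDomain public
    module FX = IsDecidableDomain DX.polyDomain
  open Degree using (monic; below)

  -- Both F[x] and F[y] are the type X.Poly; π i f ∈ F[y] is the coefficient of x^i in f ∈ F[x][y],
  -- and ι embeds F[y].
  π : ℕ → Y.Poly → X.Poly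
  π i = map (λ a → X.coeff a i)

  ι : X.Poly → Y.Poly
  ι = map (λ a → a ∷ [])

  coeff-π : ∀ i f j → X.coeff (π i f) j ≡ X.coeff (Y.coeff f j) i
  coeff-π i []      j       = ≡.refl
  coeff-π i (a ∷ f) zero    = ≡.refl
  coeff-π i (a ∷ f) (suc j) = coeff-π i f j

  coeff-ι : ∀ g j → Y.coeff (ι g) j X.≈P (X.coeff g j ∷ [])
  coeff-ι []      j       = X.nil≈cons F.refl X.nil≈nil
  coeff-ι (a ∷ g) zero    = A.refl
  coeff-ι (a ∷ g) (suc j) = coeff-ι g j

  π-cong : ∀ {f g} i → f Y.≈P g → π i f X.≈P π i g
  π-cong {f} {g} i e = X.coeff-ext λ j →
    ≡.subst₂ F._≈_ (≡.sym (coeff-π i f j)) (≡.sym (coeff-π i g j)) (X.coeff-cong (Y.coeff-cong e j) i)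

  π-ext : ∀ {f g} → (∀ i → π i f X.≈P π i g) → f Y.≈P g
  π-ext {f} {g} e = Y.coeff-ext λ j → X.coeff-ext λ i →
    ≡.subst₂ F._≈_ (coeff-π i f j) (coeff-π i g j) (X.coeff-cong (e i) j)

  ι-cong : ∀ {f g} → f X.≈P g → ι f Y.≈P ι g
  ι-cong {f} {g} e = Y.coeff-ext λ j →
    A.trans (coeff-ι f j) (A.trans (X.cons≈cons (X.coeff-cong e j) A.refl) (A.sym (coeff-ι g j)))

  π-+P : ∀ i f g → π i (f Y.+P g) X.≈P (π i f X.+P π i g)
  π-+P i f g = X.coeff-ext λ j → begin
    X.coeff (π i (f Y.+P g)) j                          ≡⟨ coeff-π i (f Y.+P g) j ⟩
    X.coeff (Y.coeff (f Y.+P g) j) i                    ≈⟨ X.coeff-cong (Y.coeff-+ f g j) i ⟩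
    X.coeff (Y.coeff f j X.+P Y.coeff g j) i            ≈⟨ X.coeff-+ (Y.coeff f j) (Y.coeff g j) i ⟩
    X.coeff (Y.coeff f j) i F.+ X.coeff (Y.coeff g j) i ≡⟨ ≡.cong₂ F._+_ (coeff-π i f j) (coeff-π i g j) ⟨
    X.coeff (π i f) j F.+ X.coeff (π i g) j             ≈⟨ X.coeff-+ (π i f) (π i g) j ⟨
    X.coeff (π i f X.+P π i g) j                        ∎
    where open SetoidReasoning F.setoid

  -- If extracting coefficients in x is multiplicative on products of y-coefficients, it is so on
  -- the polynomials. The hypothesis covers two situations: top coefficients in x (`π-*P-top`) and a
  -- left factor that is constant in x (`π-ι-*P`).
  π-*P : ∀ {k a b} g h →
    (∀ j j′ → X.coeff (Y.coeff g j X.*P Y.coeff h j′) k F.≈ X.coeff (Y.coeff g j) a F.* X.coeff (Y.coeff h j′) b) →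
    π k (g Y.*P h) X.≈P (π a g X.*P π b h)
  π-*P []      h _ = A.refl
  π-*P {k} {a} {b} (c ∷ g) h e = A.trans (π-+P k (Y.scale c h) ([] ∷ (g Y.*P h)))
    (A.+-cong {π k (Y.scale c h)} scaled (X.cons≈cons F.refl (π-*P g h (λ j → e (suc j)))))
    where
    open SetoidReasoning F.setoid
    scaled : π k (Y.scale c h) X.≈P X.scale (X.coeff c a) (π b h)
    scaled = X.coeff-ext λ j → begin
      X.coeff (π k (Y.scale c h)) j                  ≡⟨ coeff-π k (Y.scale c h) j ⟩
      X.coeff (Y.coeff (Y.scale c h) j) k            ≈⟨ X.coeff-cong (Y.coeff-scale c h j) k ⟩
      X.coeff (c X.*P Y.coeff h j) k                 ≈⟨ e 0 j ⟩
      X.coeff c a F.* X.coeff (Y.coeff h j) b        ≡⟨ ≡.cong (X.coeff c a F.*_) (coeff-π b h j) ⟨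
      X.coeff c a F.* X.coeff (π b h) j              ≈⟨ X.coeff-scale (X.coeff c a) (π b h) j ⟨
      X.coeff (X.scale (X.coeff c a) (π b h)) j      ∎

  record XBelow (k : ℕ) (f : Y.Poly) : Set (c ⊔ ℓ) where
    constructor xbelow
    field vanishes : ∀ i → k ≤ i → π i f X.≈P []
  open XBelow public

  XBelow-coeff : ∀ {k f} → XBelow k f → ∀ j → DX.Below k (Y.coeff f j)
  XBelow-coeff {f = f} b j = below λ i k≤i →
    ≡.subst (F._≈ F.0#) (coeff-π i f j) (X.coeff-cong (vanishes b i k≤i) j)

  XBelow-cong : ∀ {k f g} → f Y.≈P g → XBelow k f → XBelow k g
  XBelow-cong e b = xbelow λ i k≤i → A.trans (A.sym (π-cong i e)) (vanishes b i k≤i)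

  XBelow-mono : ∀ {j k f} → j ≤ k → XBelow j f → XBelow k f
  XBelow-mono j≤k b = xbelow λ i k≤i → vanishes b i (ℕₚ.≤-trans j≤k k≤i)

  π-*P-top : ∀ {a b} f g → XBelow (suc a) f → XBelow (suc b) g → π (a ℕ.+ b) (f Y.*P g) X.≈P (π a f X.*P π b g)
  π-*P-top {a} {b} f g bf bg = π-*P f g λ j j′ →
    DX.coeff-*P-top (Y.coeff f j) (Y.coeff g j′) a b (XBelow-coeff bf j) (XBelow-coeff bg j′)

  π-ι : ∀ i g → π (suc i) (ι g) X.≈P []
  π-ι i []      = A.refl
  π-ι i (a ∷ g) = X.cons≈nil F.refl (π-ι i g)

  π-0-ι : ∀ g → π 0 (ι g) X.≈P g
  π-0-ι []      = A.refl
  π-0-ι (a ∷ g) = X.cons≈cons F.refl (π-0-ι g)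

  π-ι-*P : ∀ i g h → π i (ι g Y.*P h) X.≈P (g X.*P π i h)
  π-ι-*P i g h = A.trans (π-*P {i} {0} {i} (ι g) h constant) (X.*P-congʳ {π 0 (ι g)} (π i h) (π-0-ι g))
    where
    constant : ∀ j j′ → X.coeff (Y.coeff (ι g) j X.*P Y.coeff h j′) i F.≈
                        X.coeff (Y.coeff (ι g) j) 0 F.* X.coeff (Y.coeff h j′) i
    constant j j′ = F.trans
      (X.coeff-cong (A.trans (X.*P-congʳ (Y.coeff h j′) (coeff-ι g j)) (X.constant-*P _ _)) i)
      (F.trans (X.coeff-scale _ (Y.coeff h j′) i) (F.*-congʳ (F.sym (X.coeff-cong (coeff-ι g j) 0))))

  XBelow-1⇒ι : ∀ {f} → XBelow 1 f → f Y.≈P ι (π 0 f)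
  XBelow-1⇒ι {f} b = π-ext λ where
    zero    → A.sym (π-0-ι (π 0 f))
    (suc i) → A.trans (vanishes b (suc i) (s≤s z≤n)) (A.sym (π-ι i (π 0 f)))

  ι-monic : ∀ {m g} → DX.Monic m g → DY.Monic m (ι g)
  ι-monic {m} {g} (monic t b) = monic
    (A.trans (coeff-ι g m) (X.cons≈cons t A.refl))
    (below λ i m<i → A.trans (coeff-ι g i) (X.cons≈nil (DX.vanish b i m<i) A.refl))

  -- The leading coefficient 1 is constant in x, so all of it lies in the part of x-degree 0. This
  -- gives `content` its monic starting point.
  π-0-monic : ∀ {m f} → DY.Monic m f → DX.Monic m (π 0 f)
  π-0-monic {m} {f} (monic t b) = monic
    (F.trans (F.reflexive (coeff-π 0 f m)) (X.coeff-cong t 0))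
    (below λ i m<i → F.trans (F.reflexive (coeff-π 0 f i)) (X.coeff-cong (DY.vanish b i m<i) 0))

  XBounded : ∀ f → ∃ λ k → XBelow k f
  XBounded []      = 0 , xbelow λ _ _ → A.refl
  XBounded (a ∷ f) with XBounded f
  ... | k , b = length a ℕ.⊔ k , xbelow λ i l≤i → X.cons≈nil
    (beyond a i (ℕₚ.≤-trans (ℕₚ.m≤m⊔n (length a) k) l≤i))
    (vanishes b i (ℕₚ.≤-trans (ℕₚ.m≤n⊔m (length a) k) l≤i))
    where
    beyond : ∀ p i → length p ≤ i → X.coeff p i F.≈ F.0#
    beyond []      i       _         = F.refl
    beyond (a ∷ p) (suc i) (s≤s l≤i) = beyond p i l≤i

  XLead : ∀ f → ¬ (f Y.≈P []) → ∃ λ a → ¬ (π a f X.≈P []) × XBelow (suc a) f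
  XLead f f≉0 = descend (proj₁ (XBounded f)) (proj₂ (XBounded f))
    where
    descend : ∀ k → XBelow k f → ∃ λ a → ¬ (π a f X.≈P []) × XBelow (suc a) f
    descend zero    b = ⊥-elim (f≉0 (π-ext λ i → vanishes b i z≤n))
    descend (suc k) b with FX.zero? (π k f)
    ... | no nz = k , nz , b
    ... | yes z = descend k (xbelow λ i k≤i → lower i (ℕₚ.m≤n⇒m<n∨m≡n k≤i))
      where
      lower : ∀ i → (k ℕ.< i) ⊎ (k ≡ i) → π i f X.≈P []
      lower i (inj₁ k<i)    = vanishes b i k<i
      lower i (inj₂ ≡.refl) = z

  -- The top coefficients in x are nonzero elements of the domain F[y]; their product is the
  -- coefficient of x^(a+b) in the product, so a + b cannot exceed d.
  XBelow-factors : ∀ {d f g} → ¬ (f Y.≈P []) → ¬ (g Y.≈P []) → XBelow (suc d) (f Y.*P g) →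
    ∃ λ a → ∃ λ b → (a ℕ.+ b ≤ d) × XBelow (suc a) f × XBelow (suc b) g
  XBelow-factors {d} {f} {g} f≉0 g≉0 bd with XLead f f≉0 | XLead g g≉0
  ... | a , nf , bf | b , ng , bg = a , b , a+b≤d , bf , bg
    where
    a+b≤d : a ℕ.+ b ≤ d
    a+b≤d with suc d ℕ.≤? a ℕ.+ b
    ... | yes d<a+b = ⊥-elim (FX.*-≉0 {π a f} {π b g} nf ng
            (A.trans (A.sym (π-*P-top f g bf bg)) (vanishes bd (a ℕ.+ b) d<a+b)))
    ... | no d≮a+b  = ℕₚ.≤-pred (ℕₚ.≰⇒> d≮a+b)

  XBelow-cofactor : ∀ {d m g} h → DX.Monic m g → XBelow d (ι g Y.*P h) → XBelow d h
  XBelow-cofactor {g = g} h mg b = xbelow λ i d≤i → DX.Below-multiple (π i h) mg (DX.Below-[]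
    (A.trans (A.sym (π-ι-*P i g h)) (vanishes b i d≤i)))

  XBelow-ι-*P : ∀ {d h} g → XBelow d h → XBelow d (ι g Y.*P h)
  XBelow-ι-*P {h = h} g b = xbelow λ i d≤i →
    A.trans (π-ι-*P i g h) (A.trans (A.*-congˡ {g} (vanishes b i d≤i)) (A.zeroʳ g))

  -- Carries a combination of the maps `π i` with multipliers in F[y], as a map instead of a list of
  -- Bézout coefficients. Homogeneity lets a factor from F[y] be pulled out.
  record Functional : Set (c ⊔ ℓ) where
    field
      apply      : Y.Poly → X.Poly
      apply-cong : ∀ {f g} → f Y.≈P g → apply f X.≈P apply g
      homogeneous : ∀ g h → apply (ι g Y.*P h) X.≈P (g X.*P apply h)
  open Functional

  -- By Bézout this says that the x-coefficients π i h of h have no common factor in F[y].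
  Primitive : Y.Poly → Set (c ⊔ ℓ)
  Primitive h = ∃ λ φ → apply φ h X.≈P A.1#

  π-functional : ℕ → Functional
  π-functional i = record { apply = π i ; apply-cong = π-cong i ; homogeneous = π-ι-*P i }

  combine : Functional → X.Poly → Functional → X.Poly → Functional
  combine φ u ψ v = record
    { apply = λ h → (apply φ h X.*P u) X.+P (apply ψ h X.*P v)
    ; apply-cong = λ {f} e → A.+-cong {apply φ f X.*P u} (X.*P-congʳ u (apply-cong φ e)) (X.*P-congʳ v (apply-cong ψ e))
    ; homogeneous = λ g h → A.trans
        (A.+-cong {apply φ (ι g Y.*P h) X.*P u}
          (A.trans (X.*P-congʳ u (homogeneous φ g h)) (A.*-assoc g (apply φ h) u))
          (A.trans (X.*P-congʳ v (homogeneous ψ g h)) (A.*-assoc g (apply ψ h) v)))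
        (A.sym (A.distribˡ g (apply φ h X.*P u) (apply ψ h X.*P v)))
    }

  -- Iterated gcd of f_0, ..., f_d. Each Bézout identity merges the functional found so far with the
  -- next `π i`, so the gcd remains a value of a functional at `f`.
  content : ∀ {n} f → DX.Monic n (π 0 f) → ∀ d → ∃ λ e → ∃ λ m → DX.Monic m e ×
    (∀ i → i ≤ d → ∃ λ y → π i f X.≈P (e X.*P y)) × (∃ λ φ → e X.≈P apply φ f)
  content {n} f mf zero = π 0 f , n , mf ,
    (λ { zero _ → A.1# , A.sym (A.*-identityʳ (π 0 f)) }) , π-functional 0 , A.refl
  content f mf (suc d) with content f mf d
  ... | e , m , me , div , φ , eφ = divisor , degree , divisor-monic , div′ ,
        combine φ u (π-functional (suc d)) v ,
        A.trans combination (A.+-congʳ {π (suc d) f X.*P v} (X.*P-congʳ u eφ))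
    where
    open Bezout isField D
    open CommonDivisor (bezout (suc m) (ℕₚ.n<1+n m) me (π (suc d) f))
    div′ : ∀ i → i ≤ suc d → ∃ λ y → π i f X.≈P (divisor X.*P y)
    div′ i i≤d with ℕₚ.m≤n⇒m<n∨m≡n i≤d
    ... | inj₂ ≡.refl = cofactorʳ , dividesʳ
    ... | inj₁ (s≤s i≤d′) with div i i≤d′
    ...   | y , eq = cofactorˡ X.*P y ,
            A.trans eq (A.trans (X.*P-congʳ y dividesˡ) (A.*-assoc divisor cofactorˡ y))

  record Decomposition (f : Y.Poly) : Set (c ⊔ ℓ) where
    field
      degree    : ℕ
      contentPart : X.Poly
      primPart : Y.Poly
      content-monic : DX.Monic degree contentPart
      factorises : f Y.≈P (ι contentPart Y.*P primPart)
      isPrimitive  : Primitive primPart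

  abstract
    decompose : ∀ {d n f} → DY.Monic n f → XBelow (suc d) f → Decomposition f
    decompose {d} {n} {f} mf bf with content f (π-0-monic mf) d
    ... | e , m , me , div , φ , eφ with DY.divMod (ι-monic me) f
    ...   | h , r , f≈ , br = record
      { degree = m ; contentPart = e ; primPart = h ; content-monic = me
      ; factorises = f≈eh
      -- Homogeneity gives `e = φ f = φ (ι e h) = e (φ h)`, and the monic `e` cancels.
      ; isPrimitive = φ , DX.Monic-cancelˡ (apply φ h) A.1# me
          (A.trans (A.sym (homogeneous φ e h)) (A.trans (A.sym (apply-cong φ f≈eh))
          (A.trans (A.sym eφ) (A.sym (A.*-identityʳ e)))))
      }
      where
      open import Algebra.Properties.Ring A.ring using (-‿distribʳ-*; x∙y⁻¹≈ε⇒x≈y)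
      divides : ∀ i → ∃ λ y → π i f X.≈P (e X.*P y)
      divides i with i ℕ.≤? d
      ... | yes i≤d = div i i≤d
      ... | no i≰d  = [] , A.trans (vanishes bf i (ℕₚ.≰⇒> i≰d)) (A.sym (A.zeroʳ e))

      -- `e` divides the coefficients of x^i in both `f` and `ι e h`, hence also that of `r`. The
      -- latter has degree below that of `e`, so it vanishes.
      π-r : ∀ i → π i r X.≈P []
      π-r i with divides i
      ... | y , eq = A.trans πr≈ (A.trans (A.*-congˡ {e} k≈0) (A.zeroʳ e))
        where
        k eh : X.Poly
        k = y X.+P (X.-P π i h)
        eh = e X.*P π i h

        ey≈ : (e X.*P y) X.≈P (eh X.+P π i r)
        ey≈ = A.trans (A.sym eq) (A.trans (π-cong i f≈) (A.trans (π-+P i (ι e Y.*P h) r) (A.+-congʳ {π i r} (π-ι-*P i e h))))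

        πr≈ : π i r X.≈P (e X.*P k)
        πr≈ = A.sym (A.trans (A.distribˡ e y (X.-P π i h))
          (A.trans (A.+-cong {e X.*P y} (A.trans ey≈ (A.+-comm eh (π i r))) (A.sym (-‿distribʳ-* e (π i h))))
          (A.trans (A.+-assoc (π i r) eh (X.-P eh))
          (A.trans (A.+-congˡ {π i r} (A.-‿inverseʳ eh)) (A.+-identityʳ (π i r))))))

        k≈0 : k X.≈P []
        k≈0 = DX.Below-multiple k me (DX.Below-cong πr≈ (below λ j m≤j →
          F.trans (F.reflexive (coeff-π i r j)) (X.coeff-cong (DY.vanish br j m≤j) i)))

      f≈eh : f Y.≈P (ι e Y.*P h)
      f≈eh = B.trans f≈ (B.trans (B.+-congˡ {ι e Y.*P h} {r} {[]} (π-ext π-r)) (B.+-identityʳ (ι e Y.*P h)))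

  -- Apply the functional that sends `h` to 1 to both factorisations. Any factor `g′` from F[y] thus
  -- divides `g`, which takes the place of Gauss's lemma.
  primitive-divides : ∀ {f} g {h} g′ k (hp : Primitive h) → f Y.≈P (ι g Y.*P h) → f Y.≈P (ι g′ Y.*P k) →
                      g X.≈P (g′ X.*P apply (proj₁ hp) k)
  primitive-divides {f} g {h} g′ k (φ , φh) e e′ =
    A.trans (A.sym (A.*-identityʳ g)) (A.trans (A.*-congˡ {g} (A.sym φh)) (A.trans (A.sym (homogeneous φ g h))
    (A.trans (apply-cong φ (B.trans (B.sym e) e′)) (homogeneous φ g′ k))))

  -- Each of the two contents divides the other, and both are monic.
  decomposition-unique : ∀ {m m′ g g′ h h′} → DX.Monic m g → DX.Monic m′ g′ → Primitive h → Primitive h′ →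
    (ι g Y.*P h) Y.≈P (ι g′ Y.*P h′) → (g X.≈P g′) × (h Y.≈P h′)
  decomposition-unique {g = g} {g′} {h} {h′} mg mg′ hp hp′ e = g≈g′ ,
    DY.Monic-cancelˡ h h′ (ι-monic mg) (B.trans e (Y.*P-congʳ h′ (ι-cong (A.sym g≈g′))))
    where
    g≈g′ : g X.≈P g′
    g≈g′ = DX.Monic-antisym (apply (proj₁ hp) h′) (apply (proj₁ hp′) h) mg′ mg
      (primitive-divides g g′ h′ hp B.refl e) (primitive-divides g′ g h hp′ B.refl (B.sym e))

-- Counting with lists

Unique-⊆-length : {A : Set} {xs ys : List A} → Unique xs → (∀ {x} → x ∈ xs → x ∈ ys) → length xs ≤ length ys
Unique-⊆-length {xs = []}     _ _ = z≤n
Unique-⊆-length {xs = x ∷ xs} u@(_ ∷ uxs) xs⊆ys with ∈-∃++ (xs⊆ys (here ≡.refl))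
... | as , bs , ≡.refl = begin
  suc (length xs)               ≤⟨ s≤s (Unique-⊆-length uxs xs⊆as++bs) ⟩
  suc (length (as ++ bs))       ≡⟨ ≡.cong suc (length-++ as) ⟩
  suc (length as ℕ.+ length bs) ≡⟨ ℕₚ.+-suc (length as) (length bs) ⟨
  length as ℕ.+ suc (length bs) ≡⟨ length-++ as ⟨
  length (as ++ x ∷ bs)         ∎
  where
  open ℕₚ.≤-Reasoning
  xs⊆as++bs : ∀ {y} → y ∈ xs → y ∈ as ++ bs
  xs⊆as++bs y∈xs with ∈-++⁻ as (xs⊆ys (there y∈xs))
  ... | inj₁ y∈as            = ∈-++⁺ˡ y∈as
  ... | inj₂ (here ≡.refl)   = ⊥-elim (Unique[x∷xs]⇒x∉xs u y∈xs)
  ... | inj₂ (there y∈bs)    = ∈-++⁺ʳ as y∈bs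

length-cartesianProductWith : {A B C : Set} (f : A → B → C) (xs : List A) (ys : List B) →
  length (cartesianProductWith f xs ys) ≡ length xs ℕ.* length ys
length-cartesianProductWith f []       ys = ≡.refl
length-cartesianProductWith f (x ∷ xs) ys = ≡.trans (length-++ (map (f x) ys))
  (≡.cong₂ ℕ._+_ (length-map (f x) ys) (length-cartesianProductWith f xs ys))

length-concatMap : {A B : Set} (f : A → List B) (xs : List A) {k : ℕ} →
  (∀ {x} → x ∈ xs → length (f x) ≡ k) → length (concatMap f xs) ≡ length xs ℕ.* k
length-concatMap f []       _ = ≡.refl
length-concatMap f (x ∷ xs) e = ≡.trans (length-++ (f x))
  (≡.cong₂ ℕ._+_ (e (here ≡.refl)) (length-concatMap f xs (λ x∈xs → e (there x∈xs))))

allVecs-suc : {A : Set} (k : ℕ) (xs : List A) → allVecs (suc k) xs ≡ cartesianProductWith _∷_ xs (allVecs k xs)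
allVecs-suc k xs = go xs
  where
  go : ∀ ys → concatMap (λ y → map (y ∷_) (allVecs k xs)) ys ≡ cartesianProductWith _∷_ ys (allVecs k xs)
  go []       = ≡.refl
  go (y ∷ ys) = ≡.cong (map (y ∷_) (allVecs k xs) ++_) (go ys)

length-allVecs : {A : Set} (k : ℕ) (xs : List A) → length (allVecs k xs) ≡ length xs ^ k
length-allVecs zero    xs = ≡.refl
length-allVecs (suc k) xs = ≡.trans (≡.cong length (allVecs-suc k xs))
  (≡.trans (length-cartesianProductWith _∷_ xs (allVecs k xs)) (≡.cong (length xs ℕ.*_) (length-allVecs k xs)))

allVecs-unique : {A : Set} (k : ℕ) {xs : List A} → Unique xs → Unique (allVecs k xs)
allVecs-unique zero    u = [] ∷ []
allVecs-unique (suc k) {xs} u = ≡.subst Unique (≡.sym (allVecs-suc k xs))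
  (cartesianProductWith⁺ _∷_ ∷-injective u (allVecs-unique k u))

allVecs-complete : {A : Set} {k : ℕ} {xs : List A} → (∀ x → x ∈ xs) → (v : Vec A k) → v ∈ allVecs k xs
allVecs-complete           all []      = here ≡.refl
allVecs-complete {k = suc k} {xs} all (x ∷ v) = ≡.subst (x ∷ v ∈_) (≡.sym (allVecs-suc k xs))
  (∈-cartesianProductWith⁺ _∷_ (all x) (allVecs-complete all v))

length-allSamples : ∀ q d n → length (allSamples q d n) ≡ (q ^ suc d) ^ n
length-allSamples q d n = ≡.trans (length-allVecs n _)
  (≡.cong (_^ n) (≡.trans (length-allVecs (suc d) (allFin q)) (≡.cong (_^ suc d) (length-tabulate {n = q} λ i → i))))

allSamples-unique : ∀ q d n → Unique (allSamples q d n)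
allSamples-unique q d n = allVecs-unique n (allVecs-unique (suc d) (allFin⁺ q))

allSamples-complete : ∀ {q d n} (s : Sample q d n) → s ∈ allSamples q d n
allSamples-complete = allVecs-complete (allVecs-complete ∈-allFin)

sample-≟ : ∀ {q d n} → DecidableEquality (Sample q d n)
sample-≟ = ≡-dec (≡-dec Data.Fin._≟_)

-- Union bound. It is applied with `is` the irreducible samples, `as` those with nontrivial content
-- and `bs` the products of small x-degree.
covered-length : {A : Set} {xs is as bs : List A} → DecidableEquality A → Unique xs →
  (∀ {x} → x ∈ xs → x ∉ as → x ∉ bs → x ∈ is) →
  length xs ≤ length is ℕ.+ (length as ℕ.+ length bs)
covered-length {xs = xs} {is} {as} {bs} _≟_ u cover = begin
  length xs               ≤⟨ Unique-⊆-length u sub ⟩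
  length (is ++ as ++ bs) ≡⟨ ≡.trans (length-++ is) (≡.cong (length is ℕ.+_) (length-++ as)) ⟩
  length is ℕ.+ (length as ℕ.+ length bs) ∎
  where
  open ℕₚ.≤-Reasoning
  open DecMembership _≟_ using (_∈?_)
  sub : ∀ {x} → x ∈ xs → x ∈ is ++ as ++ bs
  sub {x} x∈xs with x ∈? as | x ∈? bs
  ... | yes p | _     = ∈-++⁺ʳ is (∈-++⁺ˡ p)
  ... | no _  | yes p = ∈-++⁺ʳ is (∈-++⁺ʳ as p)
  ... | no ¬a | no ¬b = ∈-++⁺ˡ (cover x∈xs ¬a ¬b)

-- Inclusion and exclusion, with `cs` bounding the intersection. Here `js` is `is` without `as`: it
-- is disjoint from `as`, and together with `cs` it covers `is`.
overlap-length : {A : Set} {xs is as cs : List A} → DecidableEquality A → Unique is → Unique as →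
  (∀ x → x ∈ xs) → (∀ {x} → x ∈ is → x ∈ as → x ∈ cs) →
  length is ℕ.+ length as ≤ length xs ℕ.+ length cs
overlap-length {xs = xs} {is} {as} {cs} _≟_ uis uas all is∩as⊆cs = begin
  length is ℕ.+ length as                   ≤⟨ ℕₚ.+-monoˡ-≤ (length as) (Unique-⊆-length uis is⊆) ⟩
  length (js ++ cs) ℕ.+ length as           ≡⟨ ≡.cong (ℕ._+ length as) (≡.trans (length-++ js) (ℕₚ.+-comm (length js) _)) ⟩
  length cs ℕ.+ length js ℕ.+ length as     ≡⟨ ℕₚ.+-assoc (length cs) (length js) (length as) ⟩
  length cs ℕ.+ (length js ℕ.+ length as)   ≡⟨ ≡.cong (length cs ℕ.+_) (length-++ js) ⟨
  length cs ℕ.+ length (js ++ as)           ≤⟨ ℕₚ.+-monoʳ-≤ (length cs) (Unique-⊆-length (++⁺ (filter⁺ ∉as? uis) uas disjoint) λ {x} _ → all x) ⟩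
  length cs ℕ.+ length xs                   ≡⟨ ℕₚ.+-comm (length cs) (length xs) ⟩
  length xs ℕ.+ length cs                   ∎
  where
  open ℕₚ.≤-Reasoning
  open DecMembership _≟_ using (_∈?_)
  ∉as? = λ x → ¬? (x ∈? as)
  js = filter ∉as? is
  disjoint : ∀ {x} → ¬ (x ∈ js × x ∈ as)
  disjoint (x∈js , x∈as) = proj₂ (∈-filter⁻ ∉as? {xs = is} x∈js) x∈as
  is⊆ : ∀ {x} → x ∈ is → x ∈ js ++ cs
  is⊆ {x} x∈is with x ∈? as
  ... | yes x∈as = ∈-++⁺ʳ js (is∩as⊆cs x∈is x∈as)
  ... | no x∉as  = ∈-++⁺ˡ (∈-filter⁺ ∉as? x∈is x∉as)

-- Classification of the samples

finiteFieldDomain : {c ℓ : Level} {F : CommutativeRing c ℓ} {q : ℕ} → IsField F → HasCard F q → IsDecidableDomain F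
finiteFieldDomain {F = F} isField E = record
  { zero? = zero? ; 1≉0 = 1≉0 ; *-≉0 = *-≉0 }
  where
  open CommutativeRing F
  open IsField isField
  open HasCard E
  zero? : ∀ x → Dec (x ≈ 0#)
  zero? x with enum-surj x | enum-surj 0#
  ... | i , ei | j , ej with i Finₚ.≟ j
  ...   | yes ≡.refl = yes (trans (sym ei) ej)
  ...   | no i≢j     = no λ e → i≢j (enum-inj i j (trans ei (trans e (sym ej))))

  *-≉0 : ∀ {x y} → ¬ (x ≈ 0#) → ¬ (y ≈ 0#) → ¬ (x * y ≈ 0#)
  *-≉0 {x} {y} x≉0 y≉0 xy≈0 with inverse x x≉0
  ... | z , xz≈1 = y≉0 (begin
    y           ≈⟨ *-identityˡ y ⟨
    1# * y      ≈⟨ *-congʳ xz≈1 ⟨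
    x * z * y   ≈⟨ *-congʳ (*-comm x z) ⟩
    z * x * y   ≈⟨ *-assoc z x y ⟩
    z * (x * y) ≈⟨ *-congˡ xy≈0 ⟩
    z * 0#      ≈⟨ zeroʳ z ⟩
    0#          ∎)
    where open SetoidReasoning setoid

module Samples {c ℓ : Level} {F : CommutativeRing c ℓ} {q : ℕ} (isField : IsField F) (E : HasCard F q) where
  private
    D = finiteFieldDomain isField E
    module F = CommutativeRing F
    module X = Polynomial F
    module Y = Polynomial X.polyRing
    module A = CommutativeRing X.polyRing
    module B = CommutativeRing Y.polyRing
    module DX where
      open Degree F public
      open DomainDegree D public
    module DY where
      open Degree X.polyRing public
      open DomainDegree DX.polyDomain public
  open Degree using (monic; below)
  open HasCard E
  open Bivariate isField D

  index : F.Carrier → Fin q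
  index x = proj₁ (enum-surj x)

  enum-index : ∀ x → enum (index x) F.≈ x
  enum-index x = proj₂ (enum-surj x)

  index-cong : ∀ {x y} → x F.≈ y → index x ≡ index y
  index-cong {x} {y} e = enum-inj _ _ (F.trans (enum-index x) (F.trans e (F.sym (enum-index y))))

  index-enum : ∀ i → index (enum i) ≡ i
  index-enum i = enum-inj _ _ (enum-index (enum i))

  toVec : ∀ k → (ℕ → F.Carrier) → Vec (Fin q) k
  toVec zero    a = []
  toVec (suc k) a = index (a 0) ∷ toVec k (λ i → a (suc i))

  toSample : ∀ d n → (ℕ → X.Poly) → Sample q d n
  toSample d zero    a = []
  toSample d (suc n) a = toVec (suc d) (X.coeff (a 0)) ∷ toSample d n (λ j → a (suc j))

  f⟦_⟧ : ∀ {d n} → Sample q d n → Y.Poly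
  f⟦_⟧ = fPoly F E

  toVec-cong : ∀ k {a b} → (∀ i → a i F.≈ b i) → toVec k a ≡ toVec k b
  toVec-cong zero    e = ≡.refl
  toVec-cong (suc k) e = ≡.cong₂ _∷_ (index-cong (e 0)) (toVec-cong k (λ i → e (suc i)))

  toSample-cong : ∀ d n {a b} → (∀ j → a j X.≈P b j) → toSample d n a ≡ toSample d n b
  toSample-cong d zero    e = ≡.refl
  toSample-cong d (suc n) e =
    ≡.cong₂ _∷_ (toVec-cong (suc d) (X.coeff-cong (e 0))) (toSample-cong d n (λ j → e (suc j)))

  toVec-enum : ∀ {k} (v : Vec (Fin q) k) → toVec k (X.coeff (map enum (Vec.toList v))) ≡ v
  toVec-enum []      = ≡.refl
  toVec-enum (i ∷ v) = ≡.cong₂ _∷_ (index-enum i) (toVec-enum v)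

  enum-toVec : ∀ k {a} → (∀ i → k ≤ i → a i F.≈ F.0#) → ∀ i → X.coeff (map enum (Vec.toList (toVec k a))) i F.≈ a i
  enum-toVec zero    b i       = F.sym (b i z≤n)
  enum-toVec (suc k) b zero    = enum-index _
  enum-toVec (suc k) b (suc i) = enum-toVec k (λ j k≤j → b (suc j) (s≤s k≤j)) i

  fPoly-toSample : ∀ d n {a} → a n X.≈P A.1# → (∀ j → n ℕ.< j → a j X.≈P []) → (∀ j → DX.Below (suc d) (a j)) →
    ∀ j → Y.coeff f⟦ toSample d n a ⟧ j X.≈P a j
  fPoly-toSample d zero    t v b zero    = A.sym t
  fPoly-toSample d zero    t v b (suc j) = A.sym (v (suc j) (s≤s z≤n))
  fPoly-toSample d (suc n) t v b zero    = X.coeff-ext (enum-toVec (suc d) (DX.vanish (b 0)))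
  fPoly-toSample d (suc n) t v b (suc j) = fPoly-toSample d n t (λ i n<i → v (suc i) (s≤s n<i)) (λ i → b (suc i)) j

  abstract
    -- Truncates in both variables, hence is defined on every polynomial. It is a left inverse of
    -- `fPoly` without restriction, and a right inverse on monic polynomials of the correct degrees
    -- (`fPoly-sample`).
    sample : ∀ {d n} → Y.Poly → Sample q d n
    sample {d} {n} f = toSample d n (Y.coeff f)

    sample-cong : ∀ {d n f g} → f Y.≈P g → sample {d} {n} f ≡ sample g
    sample-cong {d} {n} e = toSample-cong d n (Y.coeff-cong e)

    sample-fPoly : ∀ {d n} (s : Sample q d n) → sample f⟦ s ⟧ ≡ s
    sample-fPoly []      = ≡.refl
    sample-fPoly (v ∷ s) = ≡.cong₂ _∷_ (toVec-enum v) (sample-fPoly s)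

    fPoly-sample : ∀ {d n f} → DY.Monic n f → XBelow (suc d) f → f⟦ sample {d} {n} f ⟧ Y.≈P f
    fPoly-sample {d} {n} (monic t v) b = Y.coeff-ext (fPoly-toSample d n t (DY.vanish v) (XBelow-coeff b))

  sample-unique : ∀ {d n f} (s : Sample q d n) → f⟦ s ⟧ Y.≈P f → s ≡ sample f
  sample-unique s e = ≡.trans (≡.sym (sample-fPoly s)) (sample-cong e)

  fPoly-injective : ∀ {d n} (s t : Sample q d n) → f⟦ s ⟧ Y.≈P f⟦ t ⟧ → s ≡ t
  fPoly-injective s t e = ≡.trans (sample-unique s e) (sample-fPoly t)

  fPoly-monic : ∀ {d n} (s : Sample q d n) → DY.Monic n f⟦ s ⟧
  fPoly-monic []      = monic A.refl (DY.Below-∷ A.1# (below λ _ _ → A.refl))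
  fPoly-monic (v ∷ s) = DY.Monic-∷ _ (fPoly-monic s)

  fPoly-XBelow : ∀ {d n} (s : Sample q d n) → XBelow (suc d) f⟦ s ⟧
  fPoly-XBelow s = xbelow (π-vanishes s)
    where
    enum-vanishes : ∀ {k} (v : Vec (Fin q) k) i → k ≤ i → X.coeff (map enum (Vec.toList v)) i F.≈ F.0#
    enum-vanishes []      i       _         = F.refl
    enum-vanishes (_ ∷ v) (suc i) (s≤s k≤i) = enum-vanishes v i k≤i

    π-vanishes : ∀ {d n} (s : Sample q d n) i → suc d ≤ i → π i f⟦ s ⟧ X.≈P []
    π-vanishes []      (suc i) _   = X.cons≈nil F.refl A.refl
    π-vanishes (v ∷ s) i       d<i = X.cons≈nil (enum-vanishes v i d<i) (π-vanishes s i d<i)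

  Monic-unit : ∀ {m f} v → DY.Monic m f → (f Y.*P v) Y.≈P B.1# → m ≡ 0
  Monic-unit {m} v mf e with DY.Monic-quotient v mf (DY.Monic-cong (B.sym e) one-monic)
    where
    one-monic : DY.Monic 0 B.1#
    one-monic = monic A.refl (DY.Below-∷ A.1# (below λ _ _ → A.refl))
  ... | j , m+j≡0 , _ = ℕₚ.m+n≡0⇒m≡0 m m+j≡0

  module _ {d n : ℕ} (t : Sample q d n) where
    open Decomposition (decompose (fPoly-monic t) (fPoly-XBelow t)) public
      renaming (degree to contentDegree; contentPart to cont; primPart to prim; content-monic to cont-monic
               ; factorises to fPoly-factorises; isPrimitive to prim-primitive)

    prim-monic : ∃ λ j → (contentDegree ℕ.+ j ≡ n) × DY.Monic j prim
    prim-monic = DY.Monic-quotient prim (ι-monic cont-monic) (DY.Monic-cong fPoly-factorises (fPoly-monic t))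

    prim-XBelow : XBelow (suc d) prim
    prim-XBelow = XBelow-cofactor prim cont-monic (XBelow-cong fPoly-factorises (fPoly-XBelow t))

  -- If t = g h with content g, then lift a t = (a + y g) h.  Removing the constant coefficient of the
  -- content inverts this, so lift is a bijection from F × samples of length n to the samples of
  -- length n + 1 with nontrivial content.
  lift : ∀ {d n} → Fin q → Sample q d n → Sample q d (suc n)
  lift a t = sample (ι (enum a ∷ cont t) Y.*P prim t)

  fPoly-lift : ∀ {d n} a (t : Sample q d n) → f⟦ lift a t ⟧ Y.≈P (ι (enum a ∷ cont t) Y.*P prim t)
  fPoly-lift a t with prim-monic t
  ... | j , eq , mj = fPoly-sample
    (≡.subst (λ k → DY.Monic (suc k) f) eq (DY.Monic-*P (ι-monic (DX.Monic-∷ (enum a) (cont-monic t))) mj))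
    (XBelow-ι-*P (enum a ∷ cont t) (prim-XBelow t))
    where f = ι (enum a ∷ cont t) Y.*P prim t

  -- The new product keeps the primitive part of the old sample, so it is itself a decomposition,
  -- with content `enum a ∷ cont s`. By uniqueness the head and tail of this list can be recovered.
  lift-injective : ∀ {d n a b} {s t : Sample q d n} → lift a s ≡ lift b t → a ≡ b × s ≡ t
  lift-injective {a = a} {b} {s} {t} e = conclude (decomposition-unique {g = g} {g′} {prim s} {prim t}
      (DX.Monic-∷ (enum a) (cont-monic s)) (DX.Monic-∷ (enum b) (cont-monic t)) (prim-primitive s) (prim-primitive t) same)
    where
    g g′ : X.Poly
    g  = enum a ∷ cont s
    g′ = enum b ∷ cont t

    same : (ι g Y.*P prim s) Y.≈P (ι g′ Y.*P prim t)
    same = B.trans (B.sym (fPoly-lift a s)) (B.trans (B.reflexive (≡.cong f⟦_⟧ e)) (fPoly-lift b t))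

    conclude : (g X.≈P g′) × (prim s Y.≈P prim t) → a ≡ b × s ≡ t
    conclude (X.cons≈cons a≈b c≈c′ , h≈h′) = enum-inj a b a≈b , fPoly-injective s t
      (B.trans (fPoly-factorises s) (B.trans (B.*-cong {ι (cont s)} (ι-cong c≈c′) h≈h′) (B.sym (fPoly-factorises t))))

  lift-surjective : ∀ {d n m g k} (s : Sample q d (suc n)) → DX.Monic (suc m) g → f⟦ s ⟧ Y.≈P (ι g Y.*P k) →
                    ∃ λ a → ∃ λ t → s ≡ lift a t
  lift-surjective {d} {n} {m} {g} {k} s mg e = peel (contentDegree s) (cont s) (cont-monic s) (prim-monic s)
    (fPoly-factorises s)
    -- `g` divides the content of `s`, which therefore has positive degree and a constant
    -- coefficient that can be removed.
    (DX.Monic-divides-≤ _ mg (cont-monic s) (primitive-divides (cont s) g k (prim-primitive s) (fPoly-factorises s) e))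
    where
    h = prim s
    peel : ∀ m₀ g₀ → DX.Monic m₀ g₀ → (∃ λ j → (m₀ ℕ.+ j ≡ suc n) × DY.Monic j h) → f⟦ s ⟧ Y.≈P (ι g₀ Y.*P h) →
           suc m ≤ m₀ → ∃ λ a → ∃ λ t → s ≡ lift a t
    peel (suc m₁) []       (monic 0≈1 _) _ _ _ = ⊥-elim (IsField.1≉0 isField (F.sym 0≈1))
    peel (suc m₁) (a ∷ g₁) mg₀ (j , ≡.refl , mj) f≈ _ = index a , t , sample-unique s
      (B.trans f≈ (B.*-cong {ι (a ∷ g₁)} (ι-cong (X.cons≈cons (F.sym (enum-index a)) (proj₁ same))) (proj₂ same)))
      where
      t : Sample q d n
      t = sample (ι g₁ Y.*P h)

      t≈ : f⟦ t ⟧ Y.≈P (ι g₁ Y.*P h)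
      t≈ = fPoly-sample (DY.Monic-*P (ι-monic (DX.Monic-tail mg₀)) mj) (XBelow-ι-*P g₁ (prim-XBelow s))

      -- `h` is still primitive, so by uniqueness the shortened product has content `g₁` and
      -- primitive part `h`; lifting it restores `s`.
      same : (g₁ X.≈P cont t) × (h Y.≈P prim t)
      same = decomposition-unique (DX.Monic-tail mg₀) (cont-monic t) (prim-primitive s) (prim-primitive t)
        (B.trans (B.sym t≈) (fPoly-factorises t))

  -- Lists of exceptional samples

  imprimitives : ∀ d n → List (Sample q d (suc n))
  imprimitives d n = cartesianProductWith lift (allFin q) (allSamples q d n)

  -- Entries may repeat, and `sample` cuts off products whose x-degree exceeds `suc d`. Both are
  -- harmless, as the list serves only as an upper bound.
  splitProducts : ∀ d n → ℕ → List (Sample q (suc d) n)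
  splitProducts d n m = cartesianProductWith (λ s t → sample (f⟦ s ⟧ Y.*P f⟦ t ⟧)) (allSamples q d m) (allSamples q d (n ℕ.∸ m))

  products : ∀ d n → List (Sample q (suc d) n)
  products d n = concatMap (splitProducts d n) (upTo (suc n))

  constants : ∀ d n → List (Sample q d n)
  constants d n = map (λ t → sample f⟦ t ⟧) (allSamples q 0 n)

  imprimitive-∈ : ∀ {d n m g k} (s : Sample q d (suc n)) → DX.Monic (suc m) g → f⟦ s ⟧ Y.≈P (ι g Y.*P k) →
                  s ∈ imprimitives d n
  imprimitive-∈ s mg e with lift-surjective s mg e
  ... | a , t , ≡.refl = ∈-cartesianProductWith⁺ lift (∈-allFin a) (allSamples-complete t)

  imprimitives-unique : ∀ d n → Unique (imprimitives d n)
  imprimitives-unique d n = cartesianProductWith⁺ lift lift-injective (allFin⁺ q) (allSamples-unique q d n)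

  product-∈ : ∀ {d a b g h} (s : Sample q (suc d) (a ℕ.+ b)) → DY.Monic a g → DY.Monic b h →
    XBelow (suc d) g → XBelow (suc d) h → f⟦ s ⟧ Y.≈P (g Y.*P h) → s ∈ products d (a ℕ.+ b)
  product-∈ {d} {a} {b} {g} {h} s ma mb bg bh e = ∈-concatMap⁺ (splitProducts d (a ℕ.+ b))
    (lose (∈-upTo⁺ (s≤s (ℕₚ.m≤m+n a b))) s∈)
    where
    b≡ : b ≡ a ℕ.+ b ℕ.∸ a
    b≡ = ≡.sym (ℕₚ.m+n∸m≡n a b)

    s≡ : s ≡ sample (f⟦ sample {d} {a} g ⟧ Y.*P f⟦ sample {d} {a ℕ.+ b ℕ.∸ a} h ⟧)
    s≡ = sample-unique s (B.trans e (B.sym (B.*-cong {f⟦ sample {d} {a} g ⟧} {g} {f⟦ sample {d} {a ℕ.+ b ℕ.∸ a} h ⟧} {h} (fPoly-sample ma bg)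
      (fPoly-sample (≡.subst (λ k → DY.Monic k h) b≡ mb) bh))))

    s∈ : s ∈ splitProducts d (a ℕ.+ b) a
    s∈ = ≡.subst (_∈ splitProducts d (a ℕ.+ b) a) (≡.sym s≡)
      (∈-cartesianProductWith⁺ (λ s t → sample (f⟦ s ⟧ Y.*P f⟦ t ⟧))
        (allSamples-complete (sample {d} {a} g)) (allSamples-complete (sample {d} {a ℕ.+ b ℕ.∸ a} h)))

  -- In the factorisation of `lift a t` the first factor has positive y-degree and is no unit. So
  -- the primitive part is a unit, hence 1 because it is monic, and the sample is its own content.
  irreducible-imprimitive : ∀ {d n} (s : Sample q d (suc n)) → Irreducible (Fxy F E) f⟦ s ⟧ →
    s ∈ imprimitives d n → s ∈ constants d (suc n)
  irreducible-imprimitive {d} {n} s (_ , irr) s∈ with ∈-cartesianProductWith⁻ lift (allFin q) (allSamples q d n) s∈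
  ... | a , t , _ , _ , ≡.refl with irr (ι (enum a ∷ cont t)) (prim t) (fPoly-lift a t) | prim-monic t
  ...   | inj₁ (v , e) | _ with () ← Monic-unit {f = ι (enum a ∷ cont t)} v (ι-monic (DX.Monic-∷ (enum a) (cont-monic t))) e
  ...   | inj₂ (v , e) | j , j≡ , mj with Monic-unit v mj e
  ...     | ≡.refl = ≡.subst (_∈ constants d (suc n)) (≡.sym s≡) (∈-map⁺ _ (allSamples-complete u))
    where
    g = enum a ∷ cont t
    u : Sample q 0 (suc n)
    u = sample (ι g)

    s≈ : f⟦ lift a t ⟧ Y.≈P ι g
    s≈ = B.trans (fPoly-lift a t) (B.trans (B.*-congˡ {ι g} (DY.Monic-0 mj)) (B.*-identityʳ (ι g)))

    u≈ : f⟦ u ⟧ Y.≈P ι g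
    u≈ = fPoly-sample (DY.Monic-cong s≈ (fPoly-monic (lift a t))) (xbelow λ { (suc i) _ → π-ι i g })

    s≡ : lift a t ≡ sample f⟦ u ⟧
    s≡ = sample-unique (lift a t) (B.trans s≈ (B.sym u≈))

  irreducible : ∀ {d n} (s : Sample q (suc d) (suc n)) → s ∉ imprimitives (suc d) n → s ∉ products d (suc n) →
                Irreducible (Fxy F E) f⟦ s ⟧
  irreducible {d} {n} s s∉A s∉B = (λ { (v , e) → nonunit (Monic-unit v (fPoly-monic s) e) }) , factor
    where
    nonunit : ¬ (suc n ≡ 0)
    nonunit ()

    factor : ∀ g h → f⟦ s ⟧ Y.≈P (g Y.*P h) → IsUnit (Fxy F E) g ⊎ IsUnit (Fxy F E) h
    factor g h e with DY.Monic-factors g h (DY.Monic-cong e (fPoly-monic s))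
    -- A monic factor of y-degree 0 equals 1, so the scalar that normalised it is an inverse of the
    -- original factor.
    ... | u , v , zero  , b    , uv , a+b , mg , mh = inj₁ ((v ∷ []) , B.trans (B.*-comm g (v ∷ [])) (DY.Monic-0 mg))
    ... | u , v , suc a , zero , uv , a+b , mg , mh = inj₂ ((u ∷ []) , B.trans (B.*-comm h (u ∷ [])) (DY.Monic-0 mh))
    ... | u , v , suc a , suc b , uv , a+b , mg , mh = ⊥-elim (split
        (XBelow-factors (DY.Lead-≉0 (DY.Monic⇒Lead mg)) (DY.Lead-≉0 (DY.Monic⇒Lead mh)) (XBelow-cong e′ (fPoly-XBelow s))))
      where
      g′ = (v ∷ []) Y.*P g
      h′ = (u ∷ []) Y.*P h

      UV : ((v ∷ []) Y.*P (u ∷ [])) Y.≈P B.1#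
      UV = Y.cons≈cons (A.trans (A.+-identityʳ (v X.*P u)) (A.trans (A.*-comm v u) uv)) B.refl

      e′ : f⟦ s ⟧ Y.≈P (g′ Y.*P h′)
      e′ = B.trans e (B.sym (regroup Y.polyRing (v ∷ []) (u ∷ []) g h UV))
        where
        regroup : ∀ {c ℓ} (R : CommutativeRing c ℓ) → let open CommutativeRing R in
          ∀ x y z w → x * y ≈ 1# → (x * z) * (y * w) ≈ z * w
        regroup R x y z w xy = begin
          (x * z) * (y * w) ≈⟨ interchange x z y w ⟩
          (x * y) * (z * w) ≈⟨ *-congʳ xy ⟩
          1# * (z * w)      ≈⟨ *-identityˡ (z * w) ⟩
          z * w             ∎
          where
          open CommutativeRing R
          open SetoidReasoning setoid
          open import Algebra.Properties.CommutativeSemigroup *-commutativeSemigroup using (interchange)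

      split : ¬ ∃ λ i → ∃ λ j → (i ℕ.+ j ≤ suc d) × XBelow (suc i) g′ × XBelow (suc j) h′
      split (zero , j , _ , bg , _) = s∉A (imprimitive-∈ {g = π 0 g′} {k = h′} s (π-0-monic mg)
        (B.trans e′ (Y.*P-congʳ {g′} h′ (XBelow-1⇒ι bg))))
      split (suc i , zero , _ , _ , bh) = s∉A (imprimitive-∈ {g = π 0 h′} {k = g′} s (π-0-monic mh)
        (B.trans e′ (B.trans (B.*-comm g′ h′) (Y.*P-congʳ {h′} g′ (XBelow-1⇒ι bh)))))
      -- Both x-degree bounds are positive with sum at most `suc d`, which leaves at most `d` for
      -- each.
      split (suc i , suc j , i+j≤ , bg , bh) = s∉B (inProducts a+b s e′)
        where
        i≤d : suc i ≤ d
        i≤d = ℕₚ.≤-pred (ℕₚ.≤-trans (s≤s (ℕₚ.m≤m+n (suc i) j)) (ℕₚ.≤-trans (ℕₚ.≤-reflexive (≡.sym (ℕₚ.+-suc (suc i) j))) i+j≤))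
        j≤d : suc j ≤ d
        j≤d = ℕₚ.≤-trans (ℕₚ.m≤n+m (suc j) i) (ℕₚ.≤-pred i+j≤)
        inProducts : ∀ {m} → suc a ℕ.+ suc b ≡ m → (s : Sample q (suc d) m) →
                     f⟦ s ⟧ Y.≈P (g′ Y.*P h′) → s ∈ products d m
        inProducts ≡.refl s e = product-∈ s mg mh (XBelow-mono (s≤s i≤d) bg) (XBelow-mono (s≤s j≤d) bh) e

  -- Cardinalities and bounds for the number of irreducible samples

  length-imprimitives : ∀ d n → length (imprimitives d n) ≡ q ℕ.* (q ^ suc d) ^ n
  length-imprimitives d n = ≡.trans (length-cartesianProductWith lift (allFin q) (allSamples q d n))
    (≡.cong₂ ℕ._*_ (length-tabulate {n = q} λ i → i) (length-allSamples q d n))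

  length-products : ∀ d n → length (products d n) ≡ suc n ℕ.* (q ^ suc d) ^ n
  length-products d n = ≡.trans (length-concatMap (splitProducts d n) (upTo (suc n)) each)
    (≡.cong (ℕ._* (q ^ suc d) ^ n) (length-upTo (suc n)))
    where
    each : ∀ {m} → m ∈ upTo (suc n) → length (splitProducts d n m) ≡ (q ^ suc d) ^ n
    each {m} m∈ = ≡.trans (length-cartesianProductWith _ (allSamples q d m) (allSamples q d (n ℕ.∸ m)))
      (≡.trans (≡.cong₂ ℕ._*_ (length-allSamples q d m) (length-allSamples q d (n ℕ.∸ m)))
      (≡.trans (≡.sym (ℕₚ.^-distribˡ-+-* (q ^ suc d) m (n ℕ.∸ m)))
               (≡.cong ((q ^ suc d) ^_) (ℕₚ.m+[n∸m]≡n (ℕₚ.≤-pred (∈-upTo⁻ m∈))))))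

  length-constants : ∀ d n → length (constants d n) ≡ (q ^ 1) ^ n
  length-constants d n = ≡.trans (length-map _ (allSamples q 0 n)) (length-allSamples q 0 n)

  module _ {d n : ℕ} (χ : Sample q (suc d) (suc n) → Bool)
           (χ-spec : ∀ s → (χ s ≡ true) ⇔ Irreducible (Fxy F E) f⟦ s ⟧) where
    private
      χ? = λ s → χ s Data.Bool.≟ true
      Q = q ^ suc (suc d)

    count-lower : Q ^ suc n ≤ count q (suc d) (suc n) χ ℕ.+ (q ℕ.* Q ^ n ℕ.+ suc (suc n) ℕ.* (q ^ suc d) ^ suc n)
    count-lower = ≡.subst₂ _≤_ (length-allSamples q (suc d) (suc n))
      (≡.cong (count q (suc d) (suc n) χ ℕ.+_) (≡.cong₂ ℕ._+_ (length-imprimitives (suc d) n) (length-products d (suc n))))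
      (covered-length sample-≟ (allSamples-unique q (suc d) (suc n)) λ {s} s∈ s∉A s∉B →
        ∈-filter⁺ χ? s∈ (Equivalence.from (χ-spec s) (irreducible s s∉A s∉B)))

    count-upper : count q (suc d) (suc n) χ ℕ.+ q ℕ.* Q ^ n ≤ Q ^ suc n ℕ.+ (q ^ 1) ^ suc n
    count-upper = ≡.subst₂ _≤_
      (≡.cong (count q (suc d) (suc n) χ ℕ.+_) (length-imprimitives (suc d) n))
      (≡.cong₂ ℕ._+_ (length-allSamples q (suc d) (suc n)) (length-constants (suc d) (suc n)))
      (overlap-length sample-≟ (filter⁺ χ? (allSamples-unique q (suc d) (suc n))) (imprimitives-unique (suc d) n)
        allSamples-complete λ {s} s∈I s∈A →
          irreducible-imprimitive s (Equivalence.to (χ-spec s) (proj₂ (∈-filter⁻ χ? {xs = allSamples q (suc d) (suc n)} s∈I))) s∈A)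

-- The limit

open import Data.Nat using (_*_)
open import Data.Rational using (ℚ; mkℚ; 1ℚ; 0ℚ; _-_; -_; ∣_∣; _<_; *<*; toℚᵘ)

-- The right side doubles at each step, whereas squares at most double from 3 onwards: `2 (3+k)^2`
-- exceeds `(4+k)^2` by `2 + 4k + k^2`. The base case is 9 < 16.
square<4*2^ : ∀ k → (3 ℕ.+ k) * (3 ℕ.+ k) ℕ.< 4 * 2 ^ (2 ℕ.+ k)
square<4*2^ zero    = ℕₚ.m≤m+n 10 6
square<4*2^ (suc k) = begin-strict
  (4 ℕ.+ k) * (4 ℕ.+ k)                             ≤⟨ ℕₚ.m≤m+n _ (2 ℕ.+ 4 * k ℕ.+ k * k) ⟩
  (4 ℕ.+ k) * (4 ℕ.+ k) ℕ.+ (2 ℕ.+ 4 * k ℕ.+ k * k) ≡⟨ double k ⟩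
  2 * ((3 ℕ.+ k) * (3 ℕ.+ k))                       <⟨ ℕₚ.*-monoʳ-< 2 (square<4*2^ k) ⟩
  2 * (4 * 2 ^ (2 ℕ.+ k))                           ≡⟨ swap (2 ^ (2 ℕ.+ k)) ⟩
  4 * 2 ^ (3 ℕ.+ k)                                 ∎
  where
  open ℕₚ.≤-Reasoning
  double : ∀ k → (4 ℕ.+ k) * (4 ℕ.+ k) ℕ.+ (2 ℕ.+ 4 * k ℕ.+ k * k) ≡ 2 * ((3 ℕ.+ k) * (3 ℕ.+ k))
  double = ℕ-Solver.solve-∀
  swap : ∀ x → 2 * (4 * x) ≡ 4 * (2 * x)
  swap = ℕ-Solver.solve-∀

-- For n = 2 + k with 4r at most k, four times the left side is at most `(3+k)^2`. This is the
-- origin of the 4 in the threshold.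
linear<2^ : ∀ r n → 2 ℕ.+ 4 * r ≤ n → suc n * r ℕ.< 2 ^ n
linear<2^ r (suc (suc k)) (s≤s (s≤s 4r≤k)) = ℕₚ.*-cancelˡ-< 4 _ _ (begin-strict
  4 * ((3 ℕ.+ k) * r)   ≡⟨ swap (3 ℕ.+ k) r ⟩
  (3 ℕ.+ k) * (4 * r)   ≤⟨ ℕₚ.*-monoʳ-≤ (3 ℕ.+ k) (ℕₚ.≤-trans 4r≤k (ℕₚ.m≤n+m k 3)) ⟩
  (3 ℕ.+ k) * (3 ℕ.+ k) <⟨ square<4*2^ k ⟩
  4 * 2 ^ (2 ℕ.+ k)     ∎)
  where
  open ℕₚ.≤-Reasoning
  swap : ∀ x y → 4 * (x * y) ≡ x * (4 * y)
  swap = ℕ-Solver.solve-∀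

∣⊖∣≤ : ∀ {m n e} → m ≤ n ℕ.+ e → n ≤ m ℕ.+ e → ℤ.∣ + m ℤ.- + n ∣ ≤ e
∣⊖∣≤ {m} {n} {e} m≤ n≤ rewrite ℤₚ.m-n≡m⊖n m n with ℕₚ.≤-total m n
... | inj₁ m≤n = ≡.subst (_≤ e) (≡.sym (ℤₚ.∣⊖∣-≤ m≤n)) (ℕₚ.m≤n+o⇒m∸n≤o n m n≤)
... | inj₂ n≤m = ≡.subst (_≤ e) (≡.sym (≡.trans (ℤₚ.∣m⊖n∣≡∣n⊖m∣ m n) (ℤₚ.∣⊖∣-≤ n≤m))) (ℕₚ.m≤n+o⇒m∸n≤o m n m≤)

-- With 1/P = K/T, the difference of ratios is (c + K - T)/T.
ratio-close : ∀ (ε : ℚ) → 0ℚ < ε → ∀ {c K T P e} → 1 ≤ T → 1 ≤ P → K * P ≡ T →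
  c ℕ.+ K ≤ T ℕ.+ e → T ≤ c ℕ.+ K ℕ.+ e → e * suc (ℚ.denominator-1 ε) ℕ.< T →
  ∣ ratio c T - (1ℚ - ratio 1 P) ∣ < ε
ratio-close ε@(mkℚ (+ zero) r-1 _) (*<* (+<+ ()))
ratio-close ε@(mkℚ -[1+ _ ] r-1 _) (*<* ())
ratio-close ε@(mkℚ +[1+ p ] r-1 _) _ {c} {K} {suc t} {suc P-1} {e} _ _ KP≡T upper lower small =
  -- Cross-multiplied, the claim is `∣ z ∣ * suc r-1 < suc p * suc t`. The left side is at most
  -- `e * suc r-1`, which is below `suc t`.
  ℚₚ.toℚᵘ-cancel-< (ℚᵘₚ.<-respˡ-≃ (ℚᵘₚ.≃-sym abs≃) (ℚᵘ.*<* (ℤₚ.<-≤-trans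
    (≡.subst₂ ℤ._<_ (ℤₚ.pos-* ℤ.∣ z ∣ (suc r-1)) ≡.refl (+<+ (ℕₚ.≤-<-trans (ℕₚ.*-monoˡ-≤ (suc r-1) (∣⊖∣≤ upper lower)) small)))
    (≡.subst (+ suc t ℤ.≤_) (ℤₚ.pos-* (suc p) (suc t)) (ℤ.+≤+ (ℕₚ.m≤m+n (suc t) _))))))
  where
  z : ℤ
  z = + (c ℕ.+ K) ℤ.- + suc t

  x : ℚ
  x = ratio c (suc t) - (1ℚ - ratio 1 (suc P-1))

  -- The cross-multiplied form of `x≃`, with T replaced by `K * P` to obtain an unconditional ring
  -- identity.
  identity : ∀ c K P → (c ℤ.* (+ 1 ℤ.* P) ℤ.+ ℤ.- (+ 1 ℤ.* P ℤ.+ -[1+ 0 ] ℤ.* + 1) ℤ.* (K ℤ.* P)) ℤ.* (K ℤ.* P)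
             ≡ (c ℤ.+ K ℤ.- K ℤ.* P) ℤ.* (K ℤ.* P ℤ.* (+ 1 ℤ.* P))
  identity = ℤ-Solver.solve-∀

  x≃ : toℚᵘ x ≃ mkℚᵘ z t
  x≃ = ℚᵘₚ.≃-trans (ℚₚ.toℚᵘ-homo-+ (ratio c (suc t)) _) (ℚᵘₚ.≃-trans
    (ℚᵘₚ.+-cong (ℚₚ.toℚᵘ-fromℚᵘ (mkℚᵘ (+ c) t)) (ℚᵘₚ.≃-trans (ℚₚ.toℚᵘ-homo‿- _) (ℚᵘₚ.-‿cong
      (ℚᵘₚ.≃-trans (ℚₚ.toℚᵘ-homo-+ 1ℚ (- ratio 1 (suc P-1))) (ℚᵘₚ.+-cong (ℚᵘₚ.≃-refl {ℚᵘ.1ℚᵘ}) (ℚᵘₚ.≃-trans (ℚₚ.toℚᵘ-homo‿- _)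
        (ℚᵘₚ.-‿cong (ℚₚ.toℚᵘ-fromℚᵘ (mkℚᵘ (+ 1) P-1)))))))))
    (*≡* eq))
    where
    KP : + K ℤ.* + suc P-1 ≡ + suc t
    KP = ≡.trans (≡.sym (ℤₚ.pos-* K (suc P-1))) (≡.cong +_ KP≡T)
    eq : (+ c ℤ.* (+ 1 ℤ.* + suc P-1) ℤ.+ ℤ.- (+ 1 ℤ.* + suc P-1 ℤ.+ -[1+ 0 ] ℤ.* + 1) ℤ.* + suc t) ℤ.* + suc t
         ≡ (+ c ℤ.+ + K ℤ.- + suc t) ℤ.* (+ suc t ℤ.* (+ 1 ℤ.* + suc P-1))
    eq = ≡.subst (λ T → (+ c ℤ.* (+ 1 ℤ.* + suc P-1) ℤ.+ ℤ.- (+ 1 ℤ.* + suc P-1 ℤ.+ -[1+ 0 ] ℤ.* + 1) ℤ.* T) ℤ.* T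
         ≡ (+ c ℤ.+ + K ℤ.- T) ℤ.* (T ℤ.* (+ 1 ℤ.* + suc P-1))) KP (identity (+ c) (+ K) (+ suc P-1))

  abs≃ : toℚᵘ ∣ x ∣ ≃ mkℚᵘ (+ ℤ.∣ z ∣) t
  abs≃ = ℚᵘₚ.≃-trans (ℚᵘₚ.≃-reflexive (toℚᵘ-∣∣ x)) (ℚᵘₚ.∣-∣-cong x≃)
    where
    toℚᵘ-∣∣ : ∀ y → toℚᵘ ∣ y ∣ ≡ ℚᵘ.∣ toℚᵘ y ∣
    toℚᵘ-∣∣ (mkℚ _ _ _) = ≡.refl

2≤card : {c ℓ : Level} {F : CommutativeRing c ℓ} {q : ℕ} → IsField F → HasCard F q → 2 ≤ q
2≤card {F = F} {q} isField E with HasCard.enum-surj E (CommutativeRing.0# F) | HasCard.enum-surj E (CommutativeRing.1# F)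
2≤card {q = suc (suc q)} _ _ | _ | _ = s≤s (s≤s z≤n)
2≤card {F = F} {q = suc zero} isField E | zero , e0 | zero , e1 = ⊥-elim (IsField.1≉0 isField (trans (sym e1) e0))
  where open CommutativeRing F

theorem1p2 : {c ℓ : Level} (d : ℕ) → 1 ≤ d → (q : ℕ) → (F : CommutativeRing c ℓ) → IsField F → (E : HasCard F q) →
    (ε : ℚ) → 0ℚ < ε → ∃ λ (N : ℕ) → (n : ℕ) → 1 ≤ n → N ≤ n →
    (χ : Sample q d n → Bool) → (∀ s → (χ s ≡ true) ⇔ Irreducible (Fxy F E) (fPoly F E s)) →
    ∣ ratio (count q d n χ) (q ^ (suc d * n)) - (1ℚ - ratio 1 (q ^ d)) ∣ < ε
theorem1p2 (suc d) _ q F isField E ε 0<ε = 2 ℕ.+ 4 * r , λ where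
    (suc n) _ N≤n χ χ-spec → conclude n N≤n χ χ-spec
  where
  open Samples isField E using (count-lower; count-upper)
  -- As `ε` is positive, it is at least `1 / r`, so it suffices that the error in the count stays
  -- below `T / r`.
  r = suc (ℚ.denominator-1 ε)
  2≤q = 2≤card isField E
  instance
    q≢0 : ℕ.NonZero q
    q≢0 = ℕ.>-nonZero (ℕₚ.≤-trans (s≤s z≤n) 2≤q)

  conclude : ∀ n → 2 ℕ.+ 4 * r ≤ suc n → (χ : Sample q (suc d) (suc n) → Bool) →
    (∀ s → (χ s ≡ true) ⇔ Irreducible (Fxy F E) (fPoly F E s)) →
    ∣ ratio (count q (suc d) (suc n) χ) (q ^ (suc (suc d) * suc n)) - (1ℚ - ratio 1 (q ^ suc d)) ∣ < ε
  conclude n N≤n χ χ-spec = ratio-close ε 0<ε {count q (suc d) (suc n) χ} {q * Q ^ n} {T} {P} {e}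
    (ℕₚ.m^n>0 q (suc (suc d) * suc n)) (ℕₚ.m^n>0 q (suc d))
    KP≡T
    (≡.subst (λ T → C ℕ.+ K ≤ T ℕ.+ e) Q^≡T (ℕₚ.≤-trans (count-upper χ χ-spec) (ℕₚ.+-monoʳ-≤ (Q ^ suc n) constants≤e)))
    (≡.subst (_≤ C ℕ.+ K ℕ.+ e) Q^≡T (≡.subst (Q ^ suc n ≤_) (≡.sym (ℕₚ.+-assoc C K e)) (count-lower χ χ-spec)))
    (≡.subst (e * r ℕ.<_) T≡ e*r<)
    where
    open ℕₚ.≤-Reasoning
    C = count q (suc d) (suc n) χ
    Q = q ^ suc (suc d)
    P = q ^ suc d
    T = q ^ (suc (suc d) * suc n)
    K = q * Q ^ n
    -- The length of the list of products, which is the error in the lower bound. It also dominates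
    -- the `q ^ suc n` constants in the upper bound, because `P` is at least `q`.
    e = suc (suc n) * P ^ suc n

    Q^≡T : Q ^ suc n ≡ T
    Q^≡T = ℕₚ.^-*-assoc q (suc (suc d)) (suc n)

    KP≡T : K * P ≡ T
    KP≡T = ≡.trans (regroup q (Q ^ n) P) Q^≡T
      where
      regroup : ∀ a b c → a * b * c ≡ a * c * b
      regroup = ℕ-Solver.solve-∀

    T≡ : q ^ suc n * P ^ suc n ≡ T
    T≡ = ≡.trans (≡.cong (q ^ suc n *_) (ℕₚ.^-*-assoc q (suc d) (suc n))) (≡.sym (ℕₚ.^-distribˡ-+-* q (suc n) (suc d * suc n)))

    constants≤e : (q ^ 1) ^ suc n ≤ e
    constants≤e = ℕₚ.≤-trans (ℕₚ.^-monoˡ-≤ (suc n) (ℕₚ.^-monoʳ-≤ q {1} {suc d} (s≤s z≤n))) (ℕₚ.m≤m+n (P ^ suc n) _)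

    e*r< : e * r ℕ.< q ^ suc n * P ^ suc n
    e*r< = begin-strict
      suc (suc n) * P ^ suc n * r   ≡⟨ regroup (suc (suc n)) (P ^ suc n) r ⟩
      suc (suc n) * r * P ^ suc n   <⟨ ℕₚ.*-monoˡ-< (P ^ suc n) {{ℕₚ.m^n≢0 P (suc n) {{ℕₚ.m^n≢0 q (suc d)}}}}
                                        (ℕₚ.<-≤-trans (linear<2^ r (suc n) N≤n) (ℕₚ.^-monoˡ-≤ (suc n) 2≤q)) ⟩
      q ^ suc n * P ^ suc n         ∎
      where
      regroup : ∀ a b c → a * b * c ≡ a * c * b
      regroup = ℕ-Solver.solve-∀
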